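{- Let $G$ be a finite $4$-connected graph. If $G$ is $k$-regular and $G\neq K_{k+1}$, then $G$ is $k$-swappable. If $G=K_{k+1}$ and $L$ is a $k$-assignment for $G$ that is not identical everywhere (i.e., $L(u)\ne L(w)$ for some $u,w\in V(G)$), then $G$ is $L$-swappable.
   Context: A list-assignment $L$ assigns to each vertex $v$ a set $L(v)$ of colors; a $k$-assignment has $|L(v)|=k$ for all $v$. An $L$-coloring is a proper coloring $\varphi$ with $\varphi(v)\in L(v)$. An $\alpha,\beta$-Kempe swap at a vertex $u$ with $\varphi(u)\in\{\alpha,\beta\}$ interchanges $\alpha$ and $\beta$ on the component containing $u$ of the subgraph induced by vertices colored $\alpha$ or $\beta$; it is $L$-valid if the result is again an $L$-coloring. Two $L$-colorings are $L$-equivalent if one is obtained from the other by a sequence of $L$-valid Kempe swaps. $G$ is $L$-swappable if it has an $L$-coloring and all its $L$-colorings are pairwise $L$-equivalent; $G$ is $k$-swappable if it is $L$-swappable for every $k$-assignment $L$. -}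

module Defs where

open import Data.Nat using (ℕ; zero; suc; _+_; _<_; _≤_)
open import Data.Bool using (Bool; true; false; if_then_else_)
open import Data.Fin using (Fin)
open import Data.Fin.Subset using (Subset; _∈_; _∉_; ∣_∣)
open import Data.List using (List; map; length; allFin)
open import Data.Nat.ListAction using (sum)
import Data.List.Membership.Propositional as LM
open import Data.List.Relation.Unary.Unique.Propositional using (Unique)
open import Data.Product using (Σ; ∃; _×_; _,_)
open import Data.Sum using (_⊎_)
open import Relation.Nullary using (¬_)
open import Relation.Binary.PropositionalEquality using (_≡_; _≢_)
open import Relation.Binary.Construct.Closure.ReflexiveTransitive using (Star)

record Graph (n : ℕ) : Set where
  field
    adj   : Fin n → Fin n → Bool
    sym   : ∀ u v → adj u v ≡ adj v u
    irrefl : ∀ v → adj v v ≡ false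
open Graph public

Adj : ∀ {n} → Graph n → Fin n → Fin n → Set
Adj G u v = adj G u v ≡ true

degree : ∀ {n} → Graph n → Fin n → ℕ
degree {n} G v = sum (map (λ w → if adj G v w then 1 else 0) (allFin n))

Regular : ∀ {n} → Graph n → ℕ → Set
Regular {n} G k = ∀ (v : Fin n) → degree G v ≡ k

IsComplete : ∀ {n} → Graph n → ℕ → Set
IsComplete {n} G m = (n ≡ m) × (∀ (u v : Fin n) → u ≢ v → Adj G u v)

data PathAvoiding {n} (G : Graph n) (S : Subset n) : Fin n → Fin n → Set where
  here  : ∀ {u} → u ∉ S → PathAvoiding G S u u
  step  : ∀ {u w v} → u ∉ S → Adj G u w → PathAvoiding G S w v → PathAvoiding G S u v

Connected : ∀ {n} → ℕ → Graph n → Set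
Connected {n} k G =
  (k < n) ×
  (∀ (S : Subset n) → ∣ S ∣ < k →
     ∀ (u v : Fin n) → u ∉ S → v ∉ S → PathAvoiding G S u v)

ListAssignment : ℕ → Set
ListAssignment n = Fin n → List ℕ

IsKAssignment : ∀ {n} → ℕ → ListAssignment n → Set
IsKAssignment {n} k L = ∀ (v : Fin n) → Unique (L v) × length (L v) ≡ k

Colouring : ℕ → Set
Colouring n = Fin n → ℕ

IsLColouring : ∀ {n} → Graph n → ListAssignment n → Colouring n → Set
IsLColouring {n} G L φ =
  (∀ (u v : Fin n) → Adj G u v → φ u ≢ φ v) × (∀ (v : Fin n) → φ v LM.∈ L v)

InPair : ℕ → ℕ → ℕ → Set
InPair α β c = (c ≡ α) ⊎ (c ≡ β)

data ABPath {n} (G : Graph n) (φ : Colouring n) (α β : ℕ) : Fin n → Fin n → Set where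
  here : ∀ {u} → InPair α β (φ u) → ABPath G φ α β u u
  step : ∀ {u w v} → InPair α β (φ u) → Adj G u w → ABPath G φ α β w v →
         ABPath G φ α β u v

swapColour : ℕ → ℕ → ℕ → ℕ → Set
swapColour α β c d = ((c ≡ α) × (d ≡ β)) ⊎ ((c ≡ β) × (d ≡ α))

KempeSwap : ∀ {n} → Graph n → Colouring n → ℕ → ℕ → Fin n → Colouring n → Set
KempeSwap {n} G φ α β u ψ =
  InPair α β (φ u) ×
  (∀ (v : Fin n) →
     (ABPath G φ α β u v → swapColour α β (φ v) (ψ v)) ×
     (¬ ABPath G φ α β u v → ψ v ≡ φ v))

LSwapStep : ∀ {n} → Graph n → ListAssignment n → Colouring n → Colouring n → Set
LSwapStep G L φ ψ =
  IsLColouring G L φ × IsLColouring G L ψ ×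
  ∃ λ α → ∃ λ β → ∃ λ u → KempeSwap G φ α β u ψ

LEquivalent : ∀ {n} → Graph n → ListAssignment n → Colouring n → Colouring n → Set
LEquivalent G L = Star (LSwapStep G L)

LSwappable : ∀ {n} → Graph n → ListAssignment n → Set
LSwappable G L =
  (∃ λ φ → IsLColouring G L φ) ×
  (∀ φ ψ → IsLColouring G L φ → IsLColouring G L ψ → LEquivalent G L φ ψ)

Swappable : ∀ {n} → Graph n → ℕ → Set
Swappable {n} G k = ∀ (L : ListAssignment n) → IsKAssignment k L → LSwappable G L

SameList : List ℕ → List ℕ → Set
SameList A B = ∀ c → (c LM.∈ A → c LM.∈ B) × (c LM.∈ B → c LM.∈ A)

{-# OPTIONS --safe #-}
module Submission where

-- Fix the colours of a set F of at most three vertices.  G − F is connected, and every remaining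
-- vertex has at least as many admissible colours as remaining neighbours.  If some remaining vertex
-- has a colour to spare, because a neighbour in F has a colour outside its list or two neighbours in
-- F are coloured alike, then the Las Vergnas–Meyniel argument shows that the L-colourings extending
-- the one on F exist and are pairwise equivalent: they form a class.  At every vertex v the k
-- neighbours avoid the colour of v, so one of them wastes a colour in this sense; hence every
-- L-colouring lies in a class with |F| ≤ 2, and it remains to link these classes.
--
-- If the lists are not all equal, every L-colouring can be moved to a class given by a single vertex
-- u with a colour α ∈ L(u) ∖ L(w), w adjacent to u, and such classes are linked by colourings lying
-- in two of them.
--
-- If the lists are all equal, the classes are given by nonadjacent pairs with a common neighbour.
-- Two disjoint pairs {x,y}, {z,t} have a common colouring unless G − {x,y,z,t} has a component C in
-- which no vertex sees both x and y, or both z and t.  Replacing x or y (or z or t) by a vertex of C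
-- makes C smaller; when this is impossible every vertex of C sees exactly one of x, y and exactly
-- one of z, t, and pairs meeting C provide the link.  Pairs sharing a vertex are linked through a
-- third pair, which exists because of k ≥ 4.

open import Defs
open import Data.Bool using (Bool; true; false; if_then_else_; _∧_; _∨_; not)
import Data.Bool.Properties as Boolₚ
open import Data.Empty using (⊥; ⊥-elim)
open import Data.Fin using (Fin; zero; suc; fromℕ<) renaming (_≟_ to _≟F_)
open import Data.Fin.Properties using (any?)
open import Data.Fin.Subset using (Subset; ∣_∣) renaming (_∈_ to _∈ₛ_)
open import Data.List using (List; []; _∷_; length; map; tabulate; filter; lookup)
import Data.List.Membership.DecPropositional as DecMem
open import Data.List.Membership.Propositional using (_∈_; _∉_; find; lose)
open import Data.List.Membership.Propositional.Properties using (∈-filter⁺; ∈-filter⁻)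
open import Data.List.Properties using (map-tabulate)
open import Data.List.Relation.Unary.All as All using (All; []; _∷_)
open import Data.List.Relation.Unary.All.Properties using (¬Any⇒All¬) renaming (All¬⇒¬Any to ∉-intro)
open import Data.List.Relation.Unary.AllPairs using (AllPairs; []; _∷_)
open import Data.List.Relation.Unary.Any as Any using (here; there; index)
open import Data.List.Relation.Unary.Any.Properties using (lookup-index)
open import Data.List.Relation.Unary.Unique.Propositional using (Unique)
open import Data.List.Relation.Unary.Unique.Propositional.Properties using () renaming (filter⁺ to unique-filter)
open import Data.Maybe using (Maybe; just; nothing; is-nothing; fromMaybe)
open import Data.Maybe.Properties using (just-injective) renaming (≡-dec to maybe-≡-dec)
open import Data.Nat using (ℕ; zero; suc; _+_; _≤_; _<_; z≤n; s≤s; s≤s⁻¹)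
open import Data.Nat.ListAction using (sum)
open import Data.Nat.Properties as ℕₚ using (≤-refl; ≤-trans; ≤-reflexive; <-≤-trans; n≤1+n; +-suc; +-identityʳ; +-comm; m≤m+n; m≤n+m; ≮⇒≥; <⇒≱; +-cancelˡ-≤; +-monoˡ-≤)
open import Data.Product using (∃; _×_; _,_; proj₁; proj₂)
open import Data.Sum using (_⊎_; inj₁; inj₂) renaming (swap to ⊎-swap)
open import Data.Vec as Vec using ()
open import Data.Vec.Properties using (lookup⇒[]=; []=⇒lookup; lookup∘tabulate)
open import Function using (_∘_; id)
open import Relation.Binary.Construct.Closure.ReflexiveTransitive using (ε; _◅_; _◅◅_; reverse)
open import Relation.Binary.PropositionalEquality using (_≡_; _≢_; refl; cong; cong₂; trans; subst) renaming (sym to ≡-sym)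
open import Relation.Nullary using (¬_; Dec; yes; no; does; ¬?)
open import Relation.Nullary.Decidable using (_×-dec_; _⊎-dec_; dec-true; dec-false; decidable-stable; map′)
open import Relation.Unary using (Decidable)

-- Counting and pigeonhole principles

-- Connectivity 4 enters through the number 3: after the removal of at most three fixed vertices,
-- one vertex with a colour to spare is reachable from everywhere. Linking two single-vertex classes
-- fixes two vertices, linking a pair to a single-vertex class fixes three. Two disjoint pairs fix
-- four, one too many, and the study of the sets `Stuck` is the price of that vertex. For
-- single-vertex classes the obstacle is different: when both ends of an edge are fixed, neither is
-- left to have a spare colour because of the other. This is why reversing an arc (`flip`) is the
-- hard case. With equal lists one fixed vertex spares nothing, so pairs are forced; a complete
-- graph has no such pair. The graph itself never changes: a fixed vertex gets a one-colour list, so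
-- all colourings remain functions on the same `Fin n`.

dec-true⁻ : ∀ {A : Set} (d : Dec A) → does d ≡ true → A
dec-true⁻ (yes p) _ = p

count : ∀ {n} → (Fin n → Bool) → ℕ
count {zero}  p = 0
count {suc n} p = (if p zero then 1 else 0) + count (p ∘ suc)

infixl 6 _∖_ _∖∖_

_∖_ : ∀ {n} → (Fin n → Bool) → Fin n → Fin n → Bool
(p ∖ w) t = p t ∧ not (does (t ≟F w))

_∖∖_ : ∀ {n} → (Fin n → Bool) → List (Fin n) → Fin n → Bool
p ∖∖ []       = p
p ∖∖ (x ∷ xs) = (p ∖ x) ∖∖ xs

∧-true : ∀ {a b} → a ∧ b ≡ true → a ≡ true × b ≡ true
∧-true {true} {true} _ = refl , refl

∧-intro : ∀ {a b} → a ≡ true → b ≡ true → a ∧ b ≡ true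
∧-intro refl refl = refl

≢true⇒false : ∀ {a} → a ≢ true → a ≡ false
≢true⇒false {true}  h = ⊥-elim (h refl)
≢true⇒false {false} h = refl

false≢true : false ≢ true
false≢true ()

∖-intro : ∀ {n} (p : Fin n → Bool) {w t} → p t ≡ true → t ≢ w → (p ∖ w) t ≡ true
∖-intro p {w} {t} pt t≢w = ∧-intro pt (cong not (dec-false (t ≟F w) t≢w))

∖-elim : ∀ {n} (p : Fin n → Bool) {w t} → (p ∖ w) t ≡ true → p t ≡ true × t ≢ w
∖-elim p {w} {t} e with ∧-true {p t} e
... | pt , q = pt , λ t≡w → false≢true (trans (≡-sym (cong not (dec-true (t ≟F w) t≡w))) q)

∖∖-intro : ∀ {n} (p : Fin n → Bool) xs {t} → p t ≡ true → t ∉ xs → (p ∖∖ xs) t ≡ true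
∖∖-intro p []       pt _  = pt
∖∖-intro p (x ∷ xs) pt t∉ = ∖∖-intro (p ∖ x) xs (∖-intro p pt (t∉ ∘ here)) (t∉ ∘ there)

∖∖-elim : ∀ {n} (p : Fin n → Bool) xs {t} → (p ∖∖ xs) t ≡ true → p t ≡ true × t ∉ xs
∖∖-elim p []       e = e , λ ()
∖∖-elim p (x ∷ xs) e with ∖∖-elim (p ∖ x) xs e
... | e′ , t∉ = proj₁ (∖-elim p e′) , λ { (here t≡x) → proj₂ (∖-elim p e′) t≡x ; (there t∈) → t∉ t∈ }

count-cong : ∀ {n} {p q : Fin n → Bool} → (∀ t → p t ≡ q t) → count p ≡ count q
count-cong {zero}  h = refl
count-cong {suc n} h = cong₂ (λ b c → (if b then 1 else 0) + c) (h zero) (count-cong (h ∘ suc))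

count-mono : ∀ {n} {p q : Fin n → Bool} → (∀ t → p t ≡ true → q t ≡ true) → count p ≤ count q
count-mono {zero}          h = z≤n
count-mono {suc n} {p} {q} h with p zero in ep | q zero in eq
... | false | false = count-mono (h ∘ suc)
... | false | true  = ≤-trans (count-mono (h ∘ suc)) (n≤1+n _)
... | true  | true  = s≤s (count-mono (h ∘ suc))
... | true  | false = ⊥-elim (false≢true (trans (≡-sym eq) (h zero ep)))

count-remove : ∀ {n} (p : Fin n → Bool) {w} → p w ≡ true → count p ≡ suc (count (p ∖ w))
count-remove {suc n} p {zero} pw rewrite pw = cong suc (count-cong λ t → ≡-sym (Boolₚ.∧-identityʳ (p (suc t))))
count-remove {suc n} p {suc w} pw with p zero
... | true  = cong suc (count-remove (p ∘ suc) pw)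
... | false = count-remove (p ∘ suc) pw

count≤1+remove : ∀ {n} (p : Fin n → Bool) w → count p ≤ suc (count (p ∖ w))
count≤1+remove p w with p w in e
... | true  = ≤-reflexive (count-remove p e)
... | false = ≤-trans (count-mono {p = p} {q = p ∖ w} λ t pt → ∖-intro p pt λ { refl → false≢true (trans (≡-sym e) pt) }) (n≤1+n _)

count≤length+removed : ∀ {n} (p : Fin n → Bool) xs → count p ≤ length xs + count (p ∖∖ xs)
count≤length+removed p []       = ≤-refl
count≤length+removed p (x ∷ xs) = ≤-trans (count≤1+remove p x) (s≤s (count≤length+removed (p ∖ x) xs))

count+length≤count : ∀ {n} (p r : Fin n → Bool) xs → Unique xs → All (λ x → r x ≡ true) xs →
  (∀ t → p t ≡ true → r t ≡ true × t ∉ xs) → count p + length xs ≤ count r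
count+length≤count p r [] _ _ h = ≤-trans (≤-reflexive (+-identityʳ _)) (count-mono λ t → proj₁ ∘ h t)
count+length≤count p r (x ∷ xs) (x≢ ∷ u) (rx ∷ rxs) h =
  ≤-trans (≤-reflexive (+-suc (count p) (length xs)))
    (≤-trans (s≤s (count+length≤count p (r ∖ x) xs u
        (All.zipWith (λ (rt , x≢t) → ∖-intro r rt (x≢t ∘ ≡-sym)) (rxs , x≢))
        λ t pt → ∖-intro r (proj₁ (h t pt)) (proj₂ (h t pt) ∘ here) , proj₂ (h t pt) ∘ there))
      (≤-reflexive (≡-sym (count-remove r rx))))

count-witness : ∀ {n} (p : Fin n → Bool) → 0 < count p → ∃ λ t → p t ≡ true
count-witness {suc n} p h with p zero in e
... | true  = zero , e
... | false with count-witness (p ∘ suc) h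
...   | t , pt = suc t , pt

pick : ∀ {n} (p : Fin n → Bool) xs → length xs < count p → ∃ λ t → p t ≡ true × t ∉ xs
pick p xs h with count-witness (p ∖∖ xs) (positive (length xs) (<-≤-trans h (count≤length+removed p xs)))
  where
  positive : ∀ a {b} → a < a + b → 0 < b
  positive zero    q       = q
  positive (suc a) (s≤s q) = positive a q
... | t , e = t , ∖∖-elim p xs e

count-∧-not : ∀ {n} (p q : Fin n → Bool) →
  count p ≡ count (λ t → p t ∧ q t) + count (λ t → p t ∧ not (q t))
count-∧-not {zero}  p q = refl
count-∧-not {suc n} p q with p zero | q zero
... | false | _     = count-∧-not (p ∘ suc) (q ∘ suc)
... | true  | true  = cong suc (count-∧-not (p ∘ suc) (q ∘ suc))
... | true  | false = trans (cong suc (count-∧-not (p ∘ suc) (q ∘ suc))) (≡-sym (+-suc _ _))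

count-all : ∀ n → count {n} (λ _ → true) ≡ n
count-all zero    = refl
count-all (suc n) = cong suc (count-all n)

degree≡count : ∀ {n} (G : Graph n) v → degree G v ≡ count (adj G v)
degree≡count G v = trans (cong sum (map-tabulate id (λ w → if adj G v w then 1 else 0))) (go (adj G v))
  where
  go : ∀ {m} (p : Fin m → Bool) → sum (tabulate (λ w → if p w then 1 else 0)) ≡ count p
  go {zero}  p = refl
  go {suc m} p = cong ((if p zero then 1 else 0) +_) (go (p ∘ suc))

-- Pigeonhole: a colour in use is charged to a vertex that has it, and that vertex leaves `p`.
-- Uniqueness of the list ensures that no later colour needs the same vertex.
uncovered : ∀ {n} (φ : Fin n → ℕ) (p : Fin n → Bool) {xs} → Unique xs → count p < length xs →
  ∃ λ c → c ∈ xs × (∀ t → p t ≡ true → φ t ≢ c)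
uncovered φ p {c ∷ xs} (c≢ ∷ u) h with any? (λ t → (p t Boolₚ.≟ true) ×-dec (φ t ℕₚ.≟ c))
... | no ¬cov = c , here refl , λ t pt e → ¬cov (t , pt , e)
... | yes (w , pw , refl) with uncovered φ (p ∖ w) u (s≤s⁻¹ (subst (_< suc (length xs)) (count-remove p pw) h))
...   | d , d∈ , free = d , there d∈ , λ t pt e →
          free t (∖-intro p pt λ { refl → All.lookup c≢ d∈ e }) e

collision : ∀ {n} (φ : Fin n → ℕ) (p : Fin n → Bool) xs → length xs < count p →
  (∃ λ t → p t ≡ true × φ t ∉ xs) ⊎ (∃ λ s → ∃ λ t → s ≢ t × p s ≡ true × p t ≡ true × φ s ≡ φ t)
collision φ p [] h with count-witness p h
... | t , pt = inj₁ (t , pt , λ ())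
collision φ p (c ∷ xs) h with any? (λ t → (p t Boolₚ.≟ true) ×-dec (φ t ℕₚ.≟ c))
... | no ¬cov with collision φ p xs (≤-trans (n≤1+n _) h)
...   | inj₁ (t , pt , t∉) = inj₁ (t , pt , λ { (here e) → ¬cov (t , pt , e) ; (there i) → t∉ i })
...   | inj₂ r = inj₂ r
collision φ p (c ∷ xs) h | yes (w , pw , e) with collision φ (p ∖ w) xs (s≤s⁻¹ (subst (suc (length xs) <_) (count-remove p pw) h))
...   | inj₂ (s , t , s≢t , ps , pt , q) = inj₂ (s , t , s≢t , proj₁ (∖-elim p ps) , proj₁ (∖-elim p pt) , q)
...   | inj₁ (t , pt , t∉) with φ t ℕₚ.≟ c
...     | yes q = inj₂ (w , t , (λ { refl → proj₂ (∖-elim p pt) refl }) , pw , proj₁ (∖-elim p pt) , trans e (≡-sym q))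
...     | no q  = inj₁ (t , proj₁ (∖-elim p pt) , λ { (here e′) → q e′ ; (there i) → t∉ i })

unique-overflow : ∀ {xs ys : List ℕ} → Unique xs → length ys < length xs → ∃ λ c → c ∈ xs × c ∉ ys
unique-overflow {xs} {ys} u h with uncovered (lookup ys) (λ _ → true) u (subst (_< length xs) (≡-sym (count-all _)) h)
... | c , c∈ , free = c , c∈ , λ c∈ys → free (index c∈ys) refl (≡-sym (lookup-index c∈ys))

-- Kempe swaps

inPair? : ∀ α β c → Dec (InPair α β c)
inPair? α β c = (c ℕₚ.≟ α) ⊎-dec (c ℕₚ.≟ β)

swapColour? : ∀ α β c d → Dec (swapColour α β c d)
swapColour? α β c d = ((c ℕₚ.≟ α) ×-dec (d ℕₚ.≟ β)) ⊎-dec ((c ℕₚ.≟ β) ×-dec (d ℕₚ.≟ α))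

swapColour⇒inPair : ∀ {α β c d} → swapColour α β c d → InPair α β c
swapColour⇒inPair (inj₁ (e , _)) = inj₁ e
swapColour⇒inPair (inj₂ (e , _)) = inj₂ e

swapColour⇒inPairʳ : ∀ {α β c d} → swapColour α β c d → InPair α β d
swapColour⇒inPairʳ (inj₁ (_ , e)) = inj₂ e
swapColour⇒inPairʳ (inj₂ (_ , e)) = inj₁ e

swapColour-sym : ∀ {α β c d} → swapColour α β c d → swapColour α β d c
swapColour-sym (inj₁ (p , q)) = inj₂ (q , p)
swapColour-sym (inj₂ (p , q)) = inj₁ (q , p)

swapColour-≢ : ∀ {α β c d} → α ≢ β → swapColour α β c d → c ≢ d
swapColour-≢ α≢β (inj₁ (refl , refl)) = α≢β
swapColour-≢ α≢β (inj₂ (refl , refl)) = α≢β ∘ ≡-sym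

swapColour-injective : ∀ {α β c d c′ d′} → swapColour α β c d → swapColour α β c′ d′ → d ≡ d′ → c ≡ c′
swapColour-injective (inj₁ (refl , refl)) (inj₁ (refl , refl)) e = refl
swapColour-injective (inj₁ (refl , refl)) (inj₂ (refl , refl)) e = ≡-sym e
swapColour-injective (inj₂ (refl , refl)) (inj₁ (refl , refl)) e = ≡-sym e
swapColour-injective (inj₂ (refl , refl)) (inj₂ (refl , refl)) e = refl

_[_≔_] : ∀ {n} → Colouring n → Fin n → ℕ → Colouring n
(φ [ v ≔ c ]) t = if does (t ≟F v) then c else φ t

≔-same : ∀ {n} (φ : Colouring n) v {c} → (φ [ v ≔ c ]) v ≡ c
≔-same φ v rewrite dec-true (v ≟F v) refl = refl

≔-other : ∀ {n} (φ : Colouring n) {v c t} → t ≢ v → (φ [ v ≔ c ]) t ≡ φ t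
≔-other φ {v} {c} {t} t≢v rewrite dec-false (t ≟F v) t≢v = refl

module _ {n : ℕ} (G : Graph n) where

  adj-sym : ∀ {u v} → Adj G u v → Adj G v u
  adj-sym {u} {v} = trans (sym G v u)

  adj⇒≢ : ∀ {u v} → Adj G u v → u ≢ v
  adj⇒≢ {u} a refl = false≢true (trans (≡-sym (irrefl G u)) a)

  Proper : Colouring n → Set
  Proper φ = ∀ u v → Adj G u v → φ u ≢ φ v

  abPath-snoc : ∀ {φ α β u v w} → ABPath G φ α β u v → Adj G v w → InPair α β (φ w) → ABPath G φ α β u w
  abPath-snoc (here p)     a q = step p a (here q)
  abPath-snoc (step p b r) a q = step p b (abPath-snoc r a q)

  abPath-end : ∀ {φ α β u v} → ABPath G φ α β u v → InPair α β (φ v)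
  abPath-end (here p)     = p
  abPath-end (step _ _ r) = abPath-end r

  abPath-reverse : ∀ {φ α β u v} → ABPath G φ α β u v → ABPath G φ α β v u
  abPath-reverse (here p)     = here p
  abPath-reverse (step p a r) = abPath-snoc (abPath-reverse r) (adj-sym a) p

  -- A Kempe swap for α ≢ β described through the set of vertices whose colour changes, so that
  -- no decision procedure for Kempe components is needed.
  record Exchange (φ : Colouring n) (α β : ℕ) (u : Fin n) (ψ : Colouring n) : Set where
    field
      start  : φ u ≢ ψ u
      swaps  : ∀ t → φ t ≢ ψ t → swapColour α β (φ t) (ψ t)
      closed : ∀ s t → φ s ≢ ψ s → Adj G s t → InPair α β (φ t) → φ t ≢ ψ t
      joined : ∀ t → φ t ≢ ψ t → ¬ ¬ ABPath G φ α β u t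
  open Exchange public

  exchange-along : ∀ {φ α β u ψ} → Exchange φ α β u ψ → ∀ {s t} → ABPath G φ α β s t → φ s ≢ ψ s → φ t ≢ ψ t
  exchange-along X (here _) c = c
  exchange-along X (step {w = w} _ a (here q)) c = closed X _ w c a q
  exchange-along X (step {w = w} _ a r@(step q _ _)) c = exchange-along X r (closed X _ w c a q)

  exchange⇒swap : ∀ {φ α β u ψ} → Exchange φ α β u ψ → KempeSwap G φ α β u ψ
  exchange⇒swap {φ} {α} {β} {u} {ψ} X =
    swapColour⇒inPair (swaps X u (start X)) , λ v → (λ r → swaps X v (exchange-along X r (start X))) , unchanged v
    where
    unchanged : ∀ v → ¬ ABPath G φ α β u v → ψ v ≡ φ v
    unchanged v ¬r with φ v ℕₚ.≟ ψ v
    ... | yes e = ≡-sym e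
    ... | no  c = ⊥-elim (joined X v c ¬r)

  swap⇒exchange : ∀ {φ α β u ψ} → α ≢ β → KempeSwap G φ α β u ψ → Exchange φ α β u ψ
  swap⇒exchange {φ} {α} {β} {u} {ψ} α≢β (pu , h) = record
    { start  = path⇒changed (here pu)
    ; swaps  = λ t c → decidable-stable (swapColour? α β (φ t) (ψ t)) λ ¬s → changed⇒path t c (¬s ∘ proj₁ (h t))
    ; closed = λ s t c a q e → changed⇒path s c λ r → path⇒changed (abPath-snoc r a q) e
    ; joined = changed⇒path }
    where
    path⇒changed : ∀ {t} → ABPath G φ α β u t → φ t ≢ ψ t
    path⇒changed {t} r = swapColour-≢ α≢β (proj₁ (h t) r)
    changed⇒path : ∀ t → φ t ≢ ψ t → ¬ ¬ ABPath G φ α β u t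
    changed⇒path t c ¬r = c (≡-sym (proj₂ (h t) ¬r))

  swap-same⇒≗ : ∀ {φ α u ψ} → KempeSwap G φ α α u ψ → ∀ t → φ t ≡ ψ t
  swap-same⇒≗ {φ} {α} {u} {ψ} (_ , h) t = decidable-stable (φ t ℕₚ.≟ ψ t) λ c →
    c (≡-sym (proj₂ (h t) λ r → c (same (proj₁ (h t) r))))
    where
    same : ∀ {c d} → swapColour α α c d → c ≡ d
    same (inj₁ (refl , refl)) = refl
    same (inj₂ (refl , refl)) = refl

  -- Pointwise equal colourings need not be identical functions. A swap whose two colours coincide
  -- changes nothing and joins them, in place of extensionality.
  ≗⇒swap-same : ∀ {φ ψ} u → (∀ t → φ t ≡ ψ t) → KempeSwap G φ (φ u) (φ u) u ψ
  ≗⇒swap-same {φ} u e = inj₁ refl , λ t → (λ r → inj₁ (end r , trans (≡-sym (e t)) (end r))) , λ _ → ≡-sym (e t)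
    where
    end : ∀ {t} → ABPath G φ (φ u) (φ u) u t → φ t ≡ φ u
    end r with abPath-end r
    ... | inj₁ q = q
    ... | inj₂ q = q

  -- A bichromatic path that starts at a changed vertex stays among changed vertices, and these keep
  -- a colour in {α, β}; hence the same path serves `ψ`.
  exchange-sym : ∀ {φ α β u ψ} → Exchange φ α β u ψ → Exchange ψ α β u φ
  exchange-sym {φ} {α} {β} {u} {ψ} X = record
    { start  = start X ∘ ≡-sym
    ; swaps  = λ t c → swapColour-sym (swaps X t (c ∘ ≡-sym))
    ; closed = λ s t c a q e → closed X s t (c ∘ ≡-sym) a (subst (InPair α β) e q) (≡-sym e)
    ; joined = λ t c ¬r → joined X t (c ∘ ≡-sym) λ r → ¬r (transport r (start X)) }
    where
    transport : ∀ {s t} → ABPath G φ α β s t → φ s ≢ ψ s → ABPath G ψ α β s t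
    transport (here _) c = here (swapColour⇒inPairʳ (swaps X _ c))
    transport (step _ a (here q)) c =
      step (swapColour⇒inPairʳ (swaps X _ c)) a (transport (here q) (closed X _ _ c a q))
    transport (step _ a r@(step q _ _)) c =
      step (swapColour⇒inPairʳ (swaps X _ c)) a (transport r (closed X _ _ c a q))

  exchange-proper : ∀ {φ α β u ψ} → Exchange φ α β u ψ → Proper φ → Proper ψ
  exchange-proper {φ} {α} {β} {u} {ψ} X proper s t a e with φ s ℕₚ.≟ ψ s | φ t ℕₚ.≟ ψ t
  ... | yes p | yes q = proper s t a (trans p (trans e (≡-sym q)))
  ... | no  p | no  q = proper s t a (swapColour-injective (swaps X s p) (swaps X t q) e)
  ... | no  p | yes q = closed X s t p a
        (subst (InPair α β) (trans e (≡-sym q)) (swapColour⇒inPairʳ (swaps X s p))) q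
  ... | yes p | no  q = closed X t s q (adj-sym a)
        (subst (InPair α β) (trans (≡-sym e) (≡-sym p)) (swapColour⇒inPairʳ (swaps X t q))) p

  module _ (L : ListAssignment n) where

    swapStep-sym : ∀ {φ ψ} → LSwapStep G L φ ψ → LSwapStep G L ψ φ
    swapStep-sym {φ} {ψ} (cφ , cψ , α , β , u , K) with α ℕₚ.≟ β
    ... | no α≢β = cψ , cφ , α , β , u , exchange⇒swap (exchange-sym (swap⇒exchange α≢β K))
    ... | yes refl = cψ , cφ , ψ u , ψ u , u , ≗⇒swap-same u (≡-sym ∘ swap-same⇒≗ K)

    equiv-sym : ∀ {φ ψ} → LEquivalent G L φ ψ → LEquivalent G L ψ φ
    equiv-sym = reverse swapStep-sym

    ≗⇒equiv : Fin n → ∀ {φ ψ} → IsLColouring G L φ → IsLColouring G L ψ → (∀ t → φ t ≡ ψ t) → LEquivalent G L φ ψ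
    ≗⇒equiv u cφ cψ e = (cφ , cψ , _ , _ , u , ≗⇒swap-same u e) ◅ ε

    exchange⇒equiv : ∀ {φ α β u ψ} → IsLColouring G L φ → IsLColouring G L ψ → Exchange φ α β u ψ → LEquivalent G L φ ψ
    exchange⇒equiv cφ cψ X = (cφ , cψ , _ , _ , _ , exchange⇒swap X) ◅ ε

    recolour : ∀ {φ ψ} v → IsLColouring G L φ → IsLColouring G L ψ → (∀ t → t ≢ v → φ t ≡ ψ t) → LEquivalent G L φ ψ
    recolour {φ} {ψ} v cφ cψ e with φ v ℕₚ.≟ ψ v
    ... | yes q = ≗⇒equiv v cφ cψ λ t → agree t
      where
      agree : ∀ t → φ t ≡ ψ t
      agree t with t ≟F v
      ... | yes refl = q
      ... | no t≢v   = e t t≢v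
    -- The two colours are the old and the new colour of `v`. No neighbour of `v` has either, so the
    -- Kempe component is `v` alone.
    ... | no q = exchange⇒equiv {α = φ v} {β = ψ v} {u = v} cφ cψ record
      { start  = q
      ; swaps  = λ t c → subst (λ s → swapColour (φ v) (ψ v) (φ s) (ψ s)) (≡-sym (at t c)) (inj₁ (refl , refl))
      ; closed = λ s t c a p _ → isolated t (subst (λ r → Adj G r t) (at s c) a) p
      ; joined = λ t c ¬r → ¬r (subst (ABPath G φ (φ v) (ψ v) v) (≡-sym (at t c)) (here (inj₁ refl))) }
      where
      at : ∀ t → φ t ≢ ψ t → t ≡ v
      at t c with t ≟F v
      ... | yes p = p
      ... | no t≢v = ⊥-elim (c (e t t≢v))
      isolated : ∀ t → Adj G v t → ¬ InPair (φ v) (ψ v) (φ t)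
      isolated t a (inj₁ p) = proj₁ cφ v t a (≡-sym p)
      isolated t a (inj₂ p) = proj₁ cψ v t a (trans (≡-sym p) (e t (adj⇒≢ a ∘ ≡-sym)))

-- Degenerate list assignments

length-filter-split : ∀ {P : ℕ → Set} (P? : Decidable P) xs →
  length xs ≡ length (filter P? xs) + length (filter (¬? ∘ P?) xs)
length-filter-split P? [] = refl
length-filter-split P? (x ∷ xs) with P? x
... | yes _ = cong suc (length-filter-split P? xs)
... | no _  = trans (cong suc (length-filter-split P? xs)) (≡-sym (+-suc _ _))

length≤1+without : ∀ a {xs} → Unique xs → length xs ≤ suc (length (filter (¬? ∘ (ℕₚ._≟ a)) xs))
length≤1+without a {xs} u = ≤-trans (≤-reflexive (length-filter-split (ℕₚ._≟ a) xs)) (+-monoˡ-≤ _ (≮⇒≥ few))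
  where
  few : ¬ 1 < length (filter (ℕₚ._≟ a) xs)
  few h with unique-overflow {ys = a ∷ []} (unique-filter (ℕₚ._≟ a) u) h
  ... | c , c∈ , c∉ = c∉ (here (proj₂ (∈-filter⁻ (ℕₚ._≟ a) {xs = xs} c∈)))

covered⇒length≤ : ∀ {n} (φ : Fin n → ℕ) (p : Fin n → Bool) {xs} → Unique xs →
  (∀ c → c ∈ xs → ∃ λ t → p t ≡ true × φ t ≡ c) → length xs ≤ count p
covered⇒length≤ φ p {xs} u cov = ≮⇒≥ λ h → let (c , c∈ , free) = uncovered φ p u h
                                               (t , pt , e) = cov c c∈ in free t pt e

∈⇒≤sum : ∀ {c xs} → c ∈ xs → c ≤ sum xs
∈⇒≤sum {xs = x ∷ xs} (here refl) = m≤m+n x (sum xs)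
∈⇒≤sum {xs = x ∷ xs} (there i)   = ≤-trans (∈⇒≤sum i) (m≤n+m (sum xs) x)

fresh-colour : ∀ {n} (M : ListAssignment n) → ∃ λ f → ∀ t → f ∉ M t
fresh-colour {n} M = suc (total M) , λ t f∈ → <⇒≱ (s≤s (bound M t)) (∈⇒≤sum f∈)
  where
  total : ∀ {m} → (Fin m → List ℕ) → ℕ
  total {zero}  M = 0
  total {suc m} M = sum (M zero) + total (M ∘ suc)
  bound : ∀ {m} (M : Fin m → List ℕ) t → sum (M t) ≤ total M
  bound M zero    = m≤m+n (sum (M zero)) _
  bound M (suc t) = ≤-trans (bound (M ∘ suc) t) (m≤n+m _ (sum (M zero)))

∈-singleton : ∀ {c d : ℕ} → c ∈ d ∷ [] → c ≡ d
∈-singleton (here e) = e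

inPair-swap : ∀ {α β a b} → a ≢ b → InPair α β a → InPair α β b → swapColour α β a b
inPair-swap a≢b (inj₁ p) (inj₁ q) = ⊥-elim (a≢b (trans p (≡-sym q)))
inPair-swap a≢b (inj₁ p) (inj₂ q) = inj₁ (p , q)
inPair-swap a≢b (inj₂ p) (inj₁ q) = inj₂ (p , q)
inPair-swap a≢b (inj₂ p) (inj₂ q) = ⊥-elim (a≢b (trans p (≡-sym q)))

swapColour-exhausts : ∀ {α β a b c} → swapColour α β a b → InPair α β c → c ≡ a ⊎ c ≡ b
swapColour-exhausts (inj₁ (refl , refl)) p = p
swapColour-exhausts (inj₂ (refl , refl)) (inj₁ p) = inj₂ p
swapColour-exhausts (inj₂ (refl , refl)) (inj₂ p) = inj₁ p

isolate : ∀ {n} → ListAssignment n → Fin n → ℕ → ListAssignment n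
isolate M v f t = if does (t ≟F v) then f ∷ [] else M t

isolate-same : ∀ {n} (M : ListAssignment n) v {f} → isolate M v f v ≡ f ∷ []
isolate-same M v rewrite dec-true (v ≟F v) refl = refl

isolate-other : ∀ {n} (M : ListAssignment n) {v f t} → t ≢ v → isolate M v f t ≡ M t
isolate-other M {v} {f} {t} t≢v rewrite dec-false (t ≟F v) t≢v = refl

-- The inductive step of the Las Vergnas–Meyniel argument.  Deleting v is modelled by giving it a
-- private fresh colour f, so that all colourings live on the same graph.
module Extend {n : ℕ} (G : Graph n) (M : ListAssignment n) (v : Fin n) (f : ℕ) (p : Fin n → Bool)
  (fresh : ∀ t → f ∉ M t) (uniq : Unique (M v)) (slack : count p < length (M v))
  (nbrs : ∀ t → Adj G v t → p t ≡ true ⊎ (∃ λ c → M t ≡ c ∷ [] × c ∉ M v)) where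

  M′ : ListAssignment n
  M′ = isolate M v f

  Extends : Colouring n → Colouring n → Set
  Extends φ χ = ∀ t → t ≢ v → φ t ≡ χ t

  ∈M : ∀ {χ} → IsLColouring G M′ χ → ∀ t → t ≢ v → χ t ∈ M t
  ∈M {χ} cχ t t≢v = subst (χ t ∈_) (isolate-other M t≢v) (proj₂ cχ t)

  at-v : ∀ {χ} → IsLColouring G M′ χ → χ v ≡ f
  at-v {χ} cχ = ∈-singleton (subst (χ v ∈_) (isolate-same M v) (proj₂ cχ v))

  ≔-colouring : ∀ {χ γ} → IsLColouring G M′ χ → γ ∈ M v → (∀ t → p t ≡ true → Adj G v t → χ t ≢ γ) →
    IsLColouring G M (χ [ v ≔ γ ])
  ≔-colouring {χ} {γ} cχ γ∈ free = proper , member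
    where
    clash : ∀ t → Adj G v t → χ t ≢ γ
    clash t a with nbrs t a
    ... | inj₁ pt = free t pt a
    ... | inj₂ (c , Mt , c∉) = λ { refl → c∉ (subst (_∈ M v) (∈-singleton (subst (χ t ∈_) Mt (∈M cχ t (adj⇒≢ G a ∘ ≡-sym)))) γ∈) }
    proper : Proper G (χ [ v ≔ γ ])
    proper s t a e with s ≟F v | t ≟F v
    ... | yes refl | yes refl = adj⇒≢ G a refl
    ... | yes refl | no _ = clash t a (≡-sym e)
    ... | no _ | yes refl = clash s (adj-sym G a) e
    ... | no _ | no _ = proj₁ cχ s t a e
    member : ∀ t → (χ [ v ≔ γ ]) t ∈ M t
    member t with t ≟F v
    ... | yes refl = γ∈
    ... | no t≢v = ∈M cχ t t≢v

  restrict : ∀ {φ} → IsLColouring G M φ → IsLColouring G M′ (φ [ v ≔ f ])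
  restrict {φ} cφ = proper , member
    where
    proper : Proper G (φ [ v ≔ f ])
    proper s t a e with s ≟F v | t ≟F v
    ... | yes refl | yes refl = adj⇒≢ G a refl
    ... | yes refl | no _ = fresh t (subst (_∈ M t) (≡-sym e) (proj₂ cφ t))
    ... | no _ | yes refl = fresh s (subst (_∈ M s) e (proj₂ cφ s))
    ... | no _ | no _ = proj₁ cφ s t a e
    member : ∀ t → (φ [ v ≔ f ]) t ∈ M′ t
    member t with t ≟F v
    ... | yes _ = here refl
    ... | no _ = proj₂ cφ t

  exists : (∃ λ χ → IsLColouring G M′ χ) → ∃ λ φ → IsLColouring G M φ
  exists (χ , cχ) with uncovered χ p uniq slack
  ... | γ , γ∈ , free = χ [ v ≔ γ ] , ≔-colouring cχ γ∈ λ t pt _ → free t pt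

  Lifted : Colouring n → Colouring n → Set
  Lifted φ χ′ = ∃ λ φ′ → IsLColouring G M φ′ × LEquivalent G M φ φ′ × Extends φ′ χ′

  module Step {χ χ′ : Colouring n} (cχ : IsLColouring G M′ χ) (cχ′ : IsLColouring G M′ χ′)
    {α β : ℕ} {u : Fin n} (X : Exchange G χ α β u χ′) where

    changed⇒≢v : ∀ {t} → χ t ≢ χ′ t → t ≢ v
    changed⇒≢v c refl = c (trans (at-v cχ) (≡-sym (at-v cχ′)))

    f∉pair : ¬ InPair α β f
    f∉pair h with swapColour-exhausts (swaps X u (start X)) h
    ... | inj₁ e = fresh u (subst (_∈ M u) (≡-sym e) (∈M cχ u (changed⇒≢v (start X))))
    ... | inj₂ e = fresh u (subst (_∈ M u) (≡-sym e) (∈M cχ′ u (changed⇒≢v (start X))))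

    inPair⇒≢v : ∀ {t} → InPair α β (χ t) → t ≢ v
    inPair⇒≢v q refl = f∉pair (subst (InPair α β) (at-v cχ) q)

    path : ∀ {φ} → Extends φ χ → ∀ {s t} → ABPath G χ α β s t → ABPath G φ α β s t
    path E (here q) = here (subst (InPair α β) (≡-sym (E _ (inPair⇒≢v q))) q)
    path E (step q a r) = step (subst (InPair α β) (≡-sym (E _ (inPair⇒≢v q))) q) a (path E r)

    -- No changed neighbour draws `v` into the chain, so the same exchange is a Kempe swap with `v`
    -- present, and `v` keeps its colour.
    stay : ∀ {φ} → IsLColouring G M φ → Extends φ χ →
      (∀ t → χ t ≢ χ′ t → Adj G t v → ¬ InPair α β (φ v)) → Lifted φ χ′
    stay {φ} cφ E off = φ′ , cφ′ , exchange⇒equiv G M cφ cφ′ Y , λ t → ≔-other χ′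
      where
      φ′ : Colouring n
      φ′ = χ′ [ v ≔ φ v ]
      at : φ′ v ≡ φ v
      at = ≔-same χ′ v
      to : ∀ {t} → φ t ≢ φ′ t → t ≢ v × χ t ≢ χ′ t
      to {t} c = t≢v , λ e → c (trans (E t t≢v) (trans e (≡-sym (≔-other χ′ t≢v))))
        where
        t≢v : t ≢ v
        t≢v refl = c (≡-sym at)
      from : ∀ {t} → χ t ≢ χ′ t → φ t ≢ φ′ t
      from {t} c e = c (trans (≡-sym (E t (changed⇒≢v c))) (trans e (≔-other χ′ (changed⇒≢v c))))
      Y : Exchange G φ α β u φ′
      Y = record
        { start  = from (start X)
        ; swaps  = λ t c → let (t≢v , c′) = to c in
            subst (λ d → swapColour α β d (φ′ t)) (≡-sym (E t t≢v))
              (subst (swapColour α β (χ t)) (≡-sym (≔-other χ′ t≢v)) (swaps X t c′))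
        ; closed = cl
        ; joined = λ t c ¬r → joined X t (proj₂ (to c)) (¬r ∘ path E) }
        where
        cl : ∀ s t → φ s ≢ φ′ s → Adj G s t → InPair α β (φ t) → φ t ≢ φ′ t
        cl s t c a q with t ≟F v
        ... | yes refl = λ _ → off s (proj₂ (to c)) a q
        ... | no t≢v = λ e → from (closed X s t (proj₂ (to c)) a (subst (InPair α β) (E t t≢v) q))
                               (trans e (≡-sym (≔-other χ′ t≢v)))
      cφ′ : IsLColouring G M φ′
      cφ′ = exchange-proper G Y (proj₁ cφ) , member
        where
        member : ∀ t → φ′ t ∈ M t
        member t with t ≟F v
        ... | yes refl = proj₂ cφ v
        ... | no t≢v = ∈M cχ′ t t≢v

    -- Here `v` would join the chain through `w`. Some `γ` other than `φ v` is used by no neighbour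
    -- except possibly `w`. If `γ` is not the colour of `w`, recolouring `v` with `γ` first takes it
    -- out of the way. If it is, then `w` is the only neighbour of `v` in the chain, so `v` is a
    -- leaf of it and can be swapped along, receiving the old colour of `w`.
    hit : ∀ {φ} → IsLColouring G M φ → Extends φ χ →
      ∀ w → χ w ≢ χ′ w → Adj G w v → InPair α β (φ v) → Lifted φ χ′
    hit {φ} cφ E w cw a qv = decide (uncovered χ (p ∖ w) (unique-filter (¬? ∘ (ℕₚ._≟ φ v)) uniq) room)
      where
      av : Adj G v w
      av = adj-sym G a
      φw : φ w ≡ χ w
      φw = E w (changed⇒≢v cw)
      φv≢χw : φ v ≢ χ w
      φv≢χw e = proj₁ cφ v w av (trans e (≡-sym φw))
      sw : swapColour α β (φ v) (χ w)
      sw = inPair-swap φv≢χw qv (swapColour⇒inPair (swaps X w cw))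
      pw : p w ≡ true
      pw with nbrs w av
      ... | inj₁ q = q
      ... | inj₂ (c , Mw , _) = ⊥-elim (cw (trans (only cχ) (≡-sym (only cχ′))))
        where
        only : ∀ {θ} → IsLColouring G M′ θ → θ w ≡ c
        only {θ} cθ = ∈-singleton (subst (θ w ∈_) Mw (∈M cθ w (changed⇒≢v cw)))
      -- The neighbours lose `w` and the colours lose `φ v`, so the strict inequality of `slack`
      -- survives.
      room : count (p ∖ w) < length (filter (¬? ∘ (ℕₚ._≟ φ v)) (M v))
      room = s≤s⁻¹ (≤-trans (subst (_< length (M v)) (count-remove p pw) slack) (length≤1+without (φ v) uniq))
      decide : (∃ λ γ → γ ∈ filter (¬? ∘ (ℕₚ._≟ φ v)) (M v) × (∀ t → (p ∖ w) t ≡ true → χ t ≢ γ)) → Lifted φ χ′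
      decide (γ , γ∈f , free) with ∈-filter⁻ (¬? ∘ (ℕₚ._≟ φ v)) {xs = M v} γ∈f | γ ℕₚ.≟ χ w
      ... | γ∈ , γ≢ | no γ≢χw =
        let (φ′ , cφ′ , eq , E′) = stay cφ₁ E₁ λ _ _ _ q → off (swapColour-exhausts sw (subst (InPair α β) (≔-same χ v) q))
        in φ′ , cφ′ , recolour G M v cφ cφ₁ (λ t t≢v → trans (E t t≢v) (≡-sym (≔-other χ t≢v))) ◅◅ eq , E′
        where
        off : ¬ (γ ≡ φ v ⊎ γ ≡ χ w)
        off (inj₁ e) = γ≢ e
        off (inj₂ e) = γ≢χw e
        avoid : ∀ t → p t ≡ true → Adj G v t → χ t ≢ γ
        avoid t pt _ with t ≟F w
        ... | yes refl = γ≢χw ∘ ≡-sym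
        ... | no t≢w   = free t (∖-intro p pt t≢w)
        cφ₁ : IsLColouring G M (χ [ v ≔ γ ])
        cφ₁ = ≔-colouring cχ γ∈ avoid
        E₁ : Extends (χ [ v ≔ γ ]) χ
        E₁ t = ≔-other χ
      ... | γ∈ , γ≢ | yes refl = φ′ , cφ′ , exchange⇒equiv G M cφ cφ′ Y , λ t → ≔-other χ′
        where
        φ′ : Colouring n
        φ′ = χ′ [ v ≔ χ w ]
        at : φ′ v ≡ χ w
        at = ≔-same χ′ v
        to : ∀ {t} → φ t ≢ φ′ t → t ≢ v → χ t ≢ χ′ t
        to {t} c t≢v e = c (trans (E t t≢v) (trans e (≡-sym (≔-other χ′ t≢v))))
        from : ∀ {t} → χ t ≢ χ′ t → φ t ≢ φ′ t
        from {t} c e = c (trans (≡-sym (E t (changed⇒≢v c))) (trans e (≔-other χ′ (changed⇒≢v c))))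
        only-w : ∀ t → Adj G v t → InPair α β (φ t) → t ≡ w
        only-w t b q with t ≟F w
        ... | yes e = e
        ... | no t≢w with swapColour-exhausts sw q
        ...   | inj₁ e = ⊥-elim (proj₁ cφ v t b (≡-sym e))
        ...   | inj₂ e with nbrs t b
        ...     | inj₁ pt = ⊥-elim (free t (∖-intro p pt t≢w) (trans (≡-sym (E t (adj⇒≢ G b ∘ ≡-sym))) e))
        ...     | inj₂ (c , Mt , c∉) = ⊥-elim (c∉ (subst (_∈ M v) (trans (≡-sym e) (∈-singleton (subst (φ t ∈_) Mt (proj₂ cφ t)))) γ∈))
        Y : Exchange G φ α β u φ′
        Y = record { start = from (start X) ; swaps = sws ; closed = cl ; joined = jn }
          where
          sws : ∀ t → φ t ≢ φ′ t → swapColour α β (φ t) (φ′ t)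
          sws t c with t ≟F v
          ... | yes refl = sw
          ... | no t≢v = subst (λ d → swapColour α β d (χ′ t)) (≡-sym (E t t≢v))
                (swaps X t λ e → c (trans (E t t≢v) e))
          cl : ∀ s t → φ s ≢ φ′ s → Adj G s t → InPair α β (φ t) → φ t ≢ φ′ t
          cl s t c b q with t ≟F v
          ... | yes refl = λ e → φv≢χw e
          ... | no t≢v with s ≟F v
          ...   | yes refl = λ e → subst (λ x → χ x ≢ χ′ x) (≡-sym (only-w t b q)) cw (trans (≡-sym (E t t≢v)) e)
          ...   | no s≢v = λ e → closed X s t (λ e′ → c (trans (E s s≢v) e′)) b (subst (InPair α β) (E t t≢v) q) (trans (≡-sym (E t t≢v)) e)
          jn : ∀ t → φ t ≢ φ′ t → ¬ ¬ ABPath G φ α β u t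
          jn t c ¬r with t ≟F v
          ... | yes refl = joined X w cw λ r → ¬r (abPath-snoc G (path E r) a qv)
          ... | no t≢v = joined X t (λ e → c (trans (E t t≢v) e)) (¬r ∘ path E)
        cφ′ : IsLColouring G M φ′
        cφ′ = exchange-proper G Y (proj₁ cφ) , member
          where
          member : ∀ t → φ′ t ∈ M t
          member t with t ≟F v
          ... | yes refl = γ∈
          ... | no t≢v = ∈M cχ′ t t≢v

    lift : ∀ {φ} → IsLColouring G M φ → Extends φ χ → Lifted φ χ′
    lift {φ} cφ E with any? (λ t → ¬? (χ t ℕₚ.≟ χ′ t) ×-dec (adj G t v Boolₚ.≟ true) ×-dec inPair? α β (φ v))
    ... | yes (w , cw , a , q) = hit cφ E w cw a q
    ... | no none = stay cφ E λ t c a q → none (t , c , a , q)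

  lift⋆ : ∀ {φ χ ψ} → LEquivalent G M′ χ ψ → IsLColouring G M φ → Extends φ χ → Lifted φ ψ
  lift⋆ ε cφ E = _ , cφ , ε , E
  lift⋆ ((cχ , cχ′ , α , β , u , K) ◅ r) cφ E with α ℕₚ.≟ β
  ... | yes refl = lift⋆ r cφ λ t t≢v → trans (E t t≢v) (swap-same⇒≗ G K t)
  ... | no α≢β = let (φ₁ , cφ₁ , eq₁ , E₁) = Step.lift cχ cχ′ (swap⇒exchange G α≢β K) cφ E
                     (φ₂ , cφ₂ , eq₂ , E₂) = lift⋆ r cφ₁ E₁
                 in φ₂ , cφ₂ , eq₁ ◅◅ eq₂ , E₂

  all-equivalent : (∀ χ χ′ → IsLColouring G M′ χ → IsLColouring G M′ χ′ → LEquivalent G M′ χ χ′) →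
    ∀ φ ψ → IsLColouring G M φ → IsLColouring G M ψ → LEquivalent G M φ ψ
  all-equivalent H φ ψ cφ cψ =
    let (φ′ , cφ′ , eq , E) = lift⋆ (H _ _ (restrict cφ) (restrict cψ)) cφ (λ t t≢v → ≡-sym (≔-other φ t≢v))
    in eq ◅◅ recolour G M v cφ′ cψ λ t t≢v → trans (E t t≢v) (≔-other ψ t≢v)

-- Elimination of vertices with a colour to spare

module _ {n : ℕ} (G : Graph n) where

  data Walk (P : Fin n → Set) : Fin n → Fin n → Set where
    stop : ∀ {u} → P u → Walk P u u
    move : ∀ {u w v} → P u → Adj G u w → Walk P w v → Walk P u v

  walk-map : ∀ {P Q : Fin n → Set} → (∀ {t} → P t → Q t) → ∀ {u v} → Walk P u v → Walk Q u v
  walk-map h (stop p)     = stop (h p)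
  walk-map h (move p a r) = move (h p) a (walk-map h r)

  walk-++ : ∀ {P : Fin n → Set} {u v w} → Walk P u v → Walk P v w → Walk P u w
  walk-++ (stop _)     s = s
  walk-++ (move p a r) s = move p a (walk-++ r s)

  walk-start : ∀ {P : Fin n → Set} {u v} → Walk P u v → P u
  walk-start (stop p)     = p
  walk-start (move p _ _) = p

  walk-reverse : ∀ {P : Fin n → Set} {u v} → Walk P u v → Walk P v u
  walk-reverse (stop p)     = stop p
  walk-reverse (move p a r) = walk-++ (walk-reverse r) (move (walk-start r) (adj-sym G a) (stop p))

  nbrsIn : (Fin n → Bool) → Fin n → Fin n → Bool
  nbrsIn pres t s = adj G t s ∧ pres s

  Slack : ListAssignment n → (Fin n → Bool) → Fin n → Set
  Slack M pres t = pres t ≡ true × count (nbrsIn pres t) < length (M t)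

  -- Absent vertices keep a colour that no neighbour may use.
  record Degenerate (M : ListAssignment n) (pres : Fin n → Bool) : Set where
    field
      unique : ∀ t → Unique (M t)
      absent : ∀ t → pres t ≡ false → ∃ λ c → M t ≡ c ∷ [] × (∀ s → Adj G t s → c ∉ M s)
      enough : ∀ t → pres t ≡ true → count (nbrsIn pres t) ≤ length (M t)
      reach  : ∀ t → pres t ≡ true → ∃ λ s → Slack M pres s × Walk (λ x → pres x ≡ true) t s
  open Degenerate

  -- The remaining lists do not shrink, while each neighbour of `v` loses a present neighbour and so
  -- gains slack. A walk that used to pass through `v` may therefore stop just before it.
  degenerate-delete : ∀ {M pres} → Degenerate M pres → ∀ {v f} → Slack M pres v → (∀ t → f ∉ M t) →
    Degenerate (isolate M v f) (pres ∖ v)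
  degenerate-delete {M} {pres} D {v} {f} (pv , sv) fresh = record
    { unique = uq ; absent = ab ; enough = en ; reach = re }
    where
    M′ = isolate M v f
    uq : ∀ t → Unique (M′ t)
    uq t with t ≟F v
    ... | yes _ = [] ∷ []
    ... | no _  = unique D t
    ab : ∀ t → (pres ∖ v) t ≡ false → ∃ λ c → M′ t ≡ c ∷ [] × (∀ s → Adj G t s → c ∉ M′ s)
    ab t e with t ≟F v
    ... | yes refl = f , refl , λ s a f∈ → fresh s (subst (f ∈_) (isolate-other M (adj⇒≢ G a ∘ ≡-sym)) f∈)
    ... | no t≢v with absent D t (trans (≡-sym (Boolₚ.∧-identityʳ (pres t))) e)
    ...   | c , Mt , off = c , Mt , free
      where
      free : ∀ s → Adj G t s → c ∉ M′ s
      free s a with s ≟F v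
      ... | yes _ = λ c∈ → fresh t (subst (f ∈_) (≡-sym Mt) (here (≡-sym (∈-singleton c∈))))
      ... | no _  = off s a
    fewer : ∀ t → count (nbrsIn (pres ∖ v) t) ≤ count (nbrsIn pres t)
    fewer t = count-mono {p = nbrsIn (pres ∖ v) t} {q = nbrsIn pres t} λ s e →
      let (a , q) = ∧-true {adj G t s} e in ∧-intro a (proj₁ (∖-elim pres q))
    same : ∀ {t} → t ≢ v → length (M t) ≤ length (M′ t)
    same t≢v = ≤-reflexive (cong length (≡-sym (isolate-other M t≢v)))
    en : ∀ t → (pres ∖ v) t ≡ true → count (nbrsIn (pres ∖ v) t) ≤ length (M′ t)
    en t e = let (pt , t≢v) = ∖-elim pres e in ≤-trans (fewer t) (≤-trans (enough D t pt) (same t≢v))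
    fewer-nbr : ∀ {t} → Adj G t v → count (nbrsIn (pres ∖ v) t) < count (nbrsIn pres t)
    fewer-nbr {t} a = ≤-trans (≤-reflexive (+-comm 1 _))
      (count+length≤count (nbrsIn (pres ∖ v) t) (nbrsIn pres t) (v ∷ []) ([] ∷ []) (∧-intro a pv ∷ [])
        λ s e → let (b , q) = ∧-true {adj G t s} e in
          ∧-intro b (proj₁ (∖-elim pres q)) , λ { (here s≡v) → proj₂ (∖-elim pres q) s≡v })
    shorten : ∀ {t s} → Walk (λ x → pres x ≡ true) t s → Slack M pres s → t ≢ v →
      ∃ λ r → Slack M′ (pres ∖ v) r × Walk (λ x → (pres ∖ v) x ≡ true) t r
    shorten (stop pt) (_ , st) t≢v =
      _ , (∖-intro pres pt t≢v , ≤-trans (s≤s (fewer _)) (≤-trans st (same t≢v))) , stop (∖-intro pres pt t≢v)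
    shorten {t} (move {w = w} pt a r) ss t≢v with w ≟F v
    ... | yes refl = t , (∖-intro pres pt t≢v , ≤-trans (fewer-nbr a) (≤-trans (enough D t pt) (same t≢v)))
                       , stop (∖-intro pres pt t≢v)
    ... | no w≢v = let (q , sq , W) = shorten r ss w≢v in q , sq , move (∖-intro pres pt t≢v) a W
    re : ∀ t → (pres ∖ v) t ≡ true → ∃ λ s → Slack M′ (pres ∖ v) s × Walk (λ x → (pres ∖ v) x ≡ true) t s
    re t e = let (pt , t≢v) = ∖-elim pres e ; (s , ss , W) = reach D t pt in shorten W ss t≢v

  -- Induction on the number of present vertices, deleting one with slack each time. When none is
  -- left, all lists are singletons and the colouring is forced.
  degenerate⇒swappable : Fin n → ∀ {M pres} → Degenerate M pres → LSwappable G M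
  degenerate⇒swappable x₀ {M₀} {pres₀} D₀ = go (count pres₀) D₀ ≤-refl
    where
    go : ∀ m {M pres} → Degenerate M pres → count pres ≤ m → LSwappable G M
    go m {M} {pres} D h with any? (λ t → pres t Boolₚ.≟ true)
    ... | no none = (φ₀ , proper , member) , λ φ ψ cφ cψ → ≗⇒equiv G M x₀ cφ cψ λ t →
                      trans (forced cφ t) (≡-sym (forced cψ t))
      where
      A : ∀ t → ∃ λ c → M t ≡ c ∷ [] × (∀ s → Adj G t s → c ∉ M s)
      A t = absent D t (≢true⇒false λ e → none (t , e))
      φ₀ : Colouring n
      φ₀ t = proj₁ (A t)
      member : ∀ t → φ₀ t ∈ M t
      member t = subst (φ₀ t ∈_) (≡-sym (proj₁ (proj₂ (A t)))) (here refl)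
      proper : Proper G φ₀
      proper s t a e = proj₂ (proj₂ (A s)) t a (subst (_∈ M t) (≡-sym e) (member t))
      forced : ∀ {φ} → IsLColouring G M φ → ∀ t → φ t ≡ φ₀ t
      forced {φ} cφ t = ∈-singleton (subst (φ t ∈_) (proj₁ (proj₂ (A t))) (proj₂ cφ t))
    go zero {M} {pres} D h | yes (t , pt) = ⊥-elim (<⇒≱ (s≤s z≤n) (subst (_≤ 0) (count-remove pres pt) h))
    go (suc m) {M} {pres} D h | yes (t , pt) with reach D t pt | fresh-colour M
    ... | v , (pv , sv) , _ | f , fresh =
      let (ex , eq) = go m (degenerate-delete D (pv , sv) fresh) (s≤s⁻¹ (subst (_≤ suc m) (count-remove pres pv) h))
      in E.exists ex , E.all-equivalent eq
      where
      split : ∀ s → Adj G v s → nbrsIn pres v s ≡ true ⊎ (∃ λ c → M s ≡ c ∷ [] × c ∉ M v)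
      split s a with pres s in e
      ... | true  = inj₁ (∧-intro a refl)
      ... | false = let (c , Ms , off) = absent D s e in inj₂ (c , Ms , off v (adj-sym G a))
      module E = Extend G M v f (nbrsIn pres v) fresh (unique D v) sv split

  -- Lists left over by a precolouring

  module _ {k : ℕ} (reg : ∀ v → count (adj G v) ≡ k) (L : ListAssignment n) (ass : IsKAssignment k L) where

    module Precoloured (fr : Fin n → Maybe ℕ) where

      pres : Fin n → Bool
      pres t = is-nothing (fr t)

      Forbidden : Fin n → ℕ → Set
      Forbidden v d = ∃ λ t → Adj G v t × fr t ≡ just d

      forbidden? : ∀ v → Decidable (Forbidden v)
      forbidden? v d = any? λ t → (adj G v t Boolₚ.≟ true) ×-dec maybe-≡-dec ℕₚ._≟_ (fr t) (just d)

      M : ListAssignment n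
      M v with fr v
      ... | just c  = c ∷ []
      ... | nothing = filter (¬? ∘ forbidden? v) (L v)

      M-just : ∀ {v c} → fr v ≡ just c → M v ≡ c ∷ []
      M-just {v} e rewrite e = refl

      M-nothing : ∀ {v} → fr v ≡ nothing → M v ≡ filter (¬? ∘ forbidden? v) (L v)
      M-nothing {v} e rewrite e = refl

      pres⇒nothing : ∀ {t} → pres t ≡ true → fr t ≡ nothing
      pres⇒nothing {t} e with fr t
      ... | nothing = refl

      nothing⇒pres : ∀ {t} → fr t ≡ nothing → pres t ≡ true
      nothing⇒pres e rewrite e = refl

      ¬pres⇒just : ∀ {t} → pres t ≡ false → ∃ λ c → fr t ≡ just c
      ¬pres⇒just {t} e with fr t
      ... | just c = c , refl

      Wasteful : Fin n → Set
      Wasteful v = (∃ λ t → ∃ λ c → Adj G v t × fr t ≡ just c × c ∉ L v)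
        ⊎ (∃ λ s → ∃ λ t → ∃ λ c → s ≢ t × Adj G v s × Adj G v t × fr s ≡ just c × fr t ≡ just c)

      Agrees : Colouring n → Set
      Agrees φ = ∀ t c → fr t ≡ just c → φ t ≡ c

      frozenNbrs : Fin n → Fin n → Bool
      frozenNbrs v t = adj G v t ∧ not (pres t)

      -- The default 0 has no effect: the counts below range over frozen neighbours.
      colour : Fin n → ℕ
      colour t = fromMaybe 0 (fr t)

      -- The `k` colours of `v` split into forbidden and admissible ones, and the forbidden ones
      -- number at most as many as any set `q` of vertices that displays them all. A smaller `q`
      -- thus means a longer list.
      list-size : ∀ v → fr v ≡ nothing → ∀ q →
        (∀ c → c ∈ filter (forbidden? v) (L v) → ∃ λ t → q t ≡ true × colour t ≡ c) →
        k ≤ count q + length (M v)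
      list-size v e q cov = ≤-trans (≤-reflexive (trans (≡-sym (proj₂ (ass v))) (length-filter-split (forbidden? v) (L v))))
        (≤-trans (+-monoˡ-≤ _ (covered⇒length≤ colour q (unique-filter (forbidden? v) (proj₁ (ass v))) cov))
          (≤-reflexive (cong (λ xs → count q + length xs) (≡-sym (M-nothing e)))))

      k-split : ∀ v → k ≡ count (frozenNbrs v) + count (nbrsIn pres v)
      k-split v = trans (≡-sym (reg v)) (trans (count-∧-not (adj G v) pres) (+-comm (count (nbrsIn pres v)) _))

      frozen-intro : ∀ {v t c} → Adj G v t → fr t ≡ just c → frozenNbrs v t ≡ true
      frozen-intro a e = ∧-intro a (cong (not ∘ is-nothing) e)

      colour-just : ∀ {t c} → fr t ≡ just c → colour t ≡ c
      colour-just = cong (fromMaybe 0)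

      enough-colours : ∀ v → fr v ≡ nothing → count (nbrsIn pres v) ≤ length (M v)
      enough-colours v e = +-cancelˡ-≤ (count (frozenNbrs v)) _ _
        (≤-trans (≤-reflexive (≡-sym (k-split v))) (list-size v e (frozenNbrs v) λ c c∈ →
          let (_ , t , a , q) = ∈-filter⁻ (forbidden? v) {xs = L v} c∈ in t , frozen-intro a q , colour-just q))

      -- A frozen neighbour w is wasted when the other frozen neighbours already forbid its colour at v.
      slack-from : ∀ v → fr v ≡ nothing → ∀ {w d} → Adj G v w → fr w ≡ just d →
        (∀ c → c ∈ L v → ∀ t → Adj G v t → fr t ≡ just c → ∃ λ s → Adj G v s × fr s ≡ just c × s ≢ w) →
        Slack M pres v
      slack-from v e {w} aw fw other = nothing⇒pres e , +-cancelˡ-≤ (count (frozenNbrs v ∖ w)) _ _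
        (≤-trans (≤-reflexive (trans (+-suc _ _) (≡-sym (trans (k-split v) (cong (_+ count (nbrsIn pres v)) (count-remove (frozenNbrs v) (frozen-intro aw fw)))))))
          (list-size v e (frozenNbrs v ∖ w) λ c c∈ →
            let (c∈L , t , a , q) = ∈-filter⁻ (forbidden? v) {xs = L v} c∈
                (s , b , q′ , s≢w) = other c c∈L t a q
            in s , ∖-intro (frozenNbrs v) (frozen-intro b q′) s≢w , colour-just q′))

      wasteful⇒slack : ∀ v → fr v ≡ nothing → Wasteful v → Slack M pres v
      wasteful⇒slack v e (inj₁ (w , d , aw , fw , d∉)) = slack-from v e aw fw λ c c∈ t a q →
        t , a , q , λ { refl → d∉ (subst (_∈ L v) (just-injective (trans (≡-sym q) fw)) c∈) }
      wasteful⇒slack v e (inj₂ (w , x , d , w≢x , aw , ax , fw , fx)) = slack-from v e aw fw other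
        where
        other : ∀ c → c ∈ L v → ∀ t → Adj G v t → fr t ≡ just c → ∃ λ s → Adj G v s × fr s ≡ just c × s ≢ w
        other c c∈ t a q with t ≟F w
        ... | yes refl = x , ax , trans fx (trans (≡-sym fw) q) , w≢x ∘ ≡-sym
        ... | no t≢w = t , a , q , t≢w

      module _ (member : ∀ t c → fr t ≡ just c → c ∈ L t)
        (proper : ∀ s t c d → Adj G s t → fr s ≡ just c → fr t ≡ just d → c ≢ d)
        (reach : ∀ t → fr t ≡ nothing → ∃ λ s → Wasteful s × Walk (λ x → fr x ≡ nothing) t s) where

        walk-end : ∀ {P : Fin n → Set} {u v} → Walk P u v → P v
        walk-end W = walk-start (walk-reverse W)

        degenerate : Degenerate M pres
        degenerate = record
          { unique = uq
          ; absent = λ t e → let (c , q) = ¬pres⇒just e in c , M-just q , off t c q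
          ; enough = λ t e → enough-colours t (pres⇒nothing e)
          ; reach  = λ t e → let (s , ws , W) = reach t (pres⇒nothing e) in
              s , wasteful⇒slack s (walk-end W) ws , walk-map nothing⇒pres W }
          where
          uq : ∀ t → Unique (M t)
          uq t with fr t
          ... | just _  = [] ∷ []
          ... | nothing = unique-filter (¬? ∘ forbidden? t) (proj₁ (ass t))
          off : ∀ t c → fr t ≡ just c → ∀ s → Adj G t s → c ∉ M s
          off t c q s a c∈ with fr s in e
          ... | just d  = proper t s c d a q e (∈-singleton c∈)
          ... | nothing = proj₂ (∈-filter⁻ (¬? ∘ forbidden? s) {xs = L s} c∈) (t , adj-sym G a , q)

        M⊆L : ∀ {t c} → c ∈ M t → c ∈ L t
        M⊆L {t} c∈ with fr t in e
        ... | just d  = subst (_∈ L t) (≡-sym (∈-singleton c∈)) (member t d e)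
        ... | nothing = proj₁ (∈-filter⁻ (¬? ∘ forbidden? t) {xs = L t} c∈)

        M⇒L : ∀ {φ} → IsLColouring G M φ → IsLColouring G L φ
        M⇒L (pr , mem) = pr , λ t → M⊆L (mem t)

        L⇒M : ∀ {φ} → IsLColouring G L φ → Agrees φ → IsLColouring G M φ
        L⇒M {φ} (pr , mem) ag = pr , mem′
          where
          mem′ : ∀ t → φ t ∈ M t
          mem′ t with fr t in e
          ... | just c  = here (ag t c e)
          ... | nothing = ∈-filter⁺ (¬? ∘ forbidden? t) (mem t) λ (s , a , q) → pr t s a (≡-sym (ag s _ q))

        M⇒agrees : ∀ {φ} → IsLColouring G M φ → Agrees φ
        M⇒agrees {φ} (_ , mem) t c e = ∈-singleton (subst (φ t ∈_) (M-just e) (mem t))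

        M-equiv⇒L-equiv : ∀ {φ ψ} → LEquivalent G M φ ψ → LEquivalent G L φ ψ
        M-equiv⇒L-equiv ε = ε
        M-equiv⇒L-equiv ((cφ , cψ , s) ◅ r) = (M⇒L cφ , M⇒L cψ , s) ◅ M-equiv⇒L-equiv r

        -- The colourings for `M` are exactly the `L`-colourings that agree with `fr`, and every
        -- swap valid for `M` is valid for `L`.
        class : Fin n → (∃ λ φ → IsLColouring G L φ × Agrees φ) ×
          (∀ φ ψ → IsLColouring G L φ → IsLColouring G L ψ → Agrees φ → Agrees ψ → LEquivalent G L φ ψ)
        class x₀ = let ((φ , cφ) , eq) = degenerate⇒swappable x₀ degenerate in
          (φ , M⇒L cφ , M⇒agrees cφ) ,
          λ φ ψ cφ cψ aφ aψ → M-equiv⇒L-equiv (eq φ ψ (L⇒M cφ aφ) (L⇒M cψ aψ))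

-- Classes of colourings with prescribed colours

_∈ℕ?_ : ∀ (c : ℕ) xs → Dec (c ∈ xs)
_∈ℕ?_ = DecMem._∈?_ ℕₚ._≟_

_∈F?_ : ∀ {n} (t : Fin n) xs → Dec (t ∈ xs)
_∈F?_ = DecMem._∈?_ _≟F_

toSubset : ∀ {n} → (Fin n → Bool) → Subset n
toSubset = Vec.tabulate

∣toSubset∣ : ∀ {n} (p : Fin n → Bool) → ∣ toSubset p ∣ ≡ count p
∣toSubset∣ {zero}  p = refl
∣toSubset∣ {suc n} p with p zero
... | true  = cong suc (∣toSubset∣ (p ∘ suc))
... | false = ∣toSubset∣ (p ∘ suc)

∈-toSubset⁺ : ∀ {n} (p : Fin n → Bool) {x} → p x ≡ true → x ∈ₛ toSubset p
∈-toSubset⁺ p {x} e = lookup⇒[]= x _ (trans (lookup∘tabulate p x) e)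

∈-toSubset⁻ : ∀ {n} (p : Fin n → Bool) {x} → x ∈ₛ toSubset p → p x ≡ true
∈-toSubset⁻ p {x} i = trans (≡-sym (lookup∘tabulate p x)) ([]=⇒lookup i)

elem : ∀ {n} → List (Fin n) → Fin n → Bool
elem xs t = does (t ∈F? xs)

elem⁺ : ∀ {n} {xs : List (Fin n)} {t} → t ∈ xs → elem xs t ≡ true
elem⁺ {xs = xs} {t} = dec-true (t ∈F? xs)

elem⁻ : ∀ {n} {xs : List (Fin n)} {t} → elem xs t ≡ true → t ∈ xs
elem⁻ {xs = xs} {t} e with t ∈F? xs
... | yes i = i

count-elem≤ : ∀ {n} (xs : List (Fin n)) → count (elem xs) ≤ length xs
count-elem≤ xs = ≮⇒≥ λ h → let (t , e , t∉) = pick (elem xs) xs h in t∉ (elem⁻ e)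

Precolouring : ℕ → Set
Precolouring n = List (Fin n × ℕ)

dom : ∀ {n} → Precolouring n → List (Fin n)
dom = map proj₁

look : ∀ {n} → Precolouring n → Fin n → Maybe ℕ
look []            v = nothing
look ((t , c) ∷ F) v = if does (v ≟F t) then just c else look F v

look-nothing⁻ : ∀ {n} (F : Precolouring n) {v} → look F v ≡ nothing → v ∉ dom F
look-nothing⁻ ((t , c) ∷ F) {v} e i with v ≟F t
look-nothing⁻ ((t , c) ∷ F) {v} e (here p)  | no v≢t = v≢t p
look-nothing⁻ ((t , c) ∷ F) {v} e (there i) | no v≢t = look-nothing⁻ F e i

look-nothing⁺ : ∀ {n} (F : Precolouring n) {v} → v ∉ dom F → look F v ≡ nothing
look-nothing⁺ []            h = refl
look-nothing⁺ ((t , c) ∷ F) {v} h with v ≟F t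
... | yes p = ⊥-elim (h (here p))
... | no _  = look-nothing⁺ F (h ∘ there)

look-just⁻ : ∀ {n} (F : Precolouring n) {v c} → look F v ≡ just c → (v , c) ∈ F
look-just⁻ ((t , d) ∷ F) {v} e with v ≟F t
look-just⁻ ((t , d) ∷ F) {v} refl | yes refl = here refl
... | no _ = there (look-just⁻ F e)

pattern 0th = here refl
pattern 1st = there (here refl)
pattern 2nd = there (there (here refl))
pattern 3rd = there (there (there (here refl)))

module Colourings {n : ℕ} (G : Graph n) (connected : Connected 4 G) {k : ℕ}
  (reg : ∀ v → count (adj G v) ≡ k) (L : ListAssignment n) (ass : IsKAssignment k L) where

  x₀ : Fin n
  x₀ = fromℕ< (proj₁ connected)

  infix 4 _∼_ _~_
  _∼_ : Colouring n → Colouring n → Set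
  _∼_ = LEquivalent G L

  _~_ : Fin n → Fin n → Set
  _~_ = Adj G

  LCol : Colouring n → Set
  LCol = IsLColouring G L

  ~-sym : ∀ {u v} → u ~ v → v ~ u
  ~-sym = adj-sym G

  ~⇒≢ : ∀ {u v} → u ~ v → u ≢ v
  ~⇒≢ = adj⇒≢ G

  _~?_ : ∀ u v → Dec (u ~ v)
  u ~? v = adj G u v Boolₚ.≟ true

  walk-avoiding : ∀ xs → length xs ≤ 3 → ∀ {u v} → u ∉ xs → v ∉ xs → Walk G (_∉ xs) u v
  walk-avoiding xs h {u} {v} u∉ v∉ =
    convert (proj₂ connected (toSubset (elem xs)) (s≤s (≤-trans (≤-reflexive (∣toSubset∣ (elem xs))) (≤-trans (count-elem≤ xs) h))) u v
      (u∉ ∘ elem⁻ ∘ ∈-toSubset⁻ (elem xs)) (v∉ ∘ elem⁻ ∘ ∈-toSubset⁻ (elem xs)))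
    where
    convert : ∀ {s t} → PathAvoiding G (toSubset (elem xs)) s t → Walk G (_∉ xs) s t
    convert (here p)     = stop (p ∘ ∈-toSubset⁺ (elem xs) ∘ elem⁺)
    convert (step p a r) = move (p ∘ ∈-toSubset⁺ (elem xs) ∘ elem⁺) a (convert r)

  Compatible : Fin n × ℕ → Fin n × ℕ → Set
  Compatible (s , c) (t , d) = s ≢ t × (s ~ t → c ≢ d)

  record Valid (F : Precolouring n) : Set where
    constructor valid
    field
      member     : All (λ (t , c) → c ∈ L t) F
      compatible : AllPairs Compatible F
  open Valid

  Holds : Precolouring n → Colouring n → Set
  Holds F φ = All (λ (t , c) → φ t ≡ c) F

  Waste : Precolouring n → Fin n → Set
  Waste F v = (∃ λ t → ∃ λ c → (t , c) ∈ F × v ~ t × c ∉ L v)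
    ⊎ (∃ λ s → ∃ λ t → ∃ λ c → s ≢ t × (s , c) ∈ F × (t , c) ∈ F × v ~ s × v ~ t)

  record Class (F : Precolouring n) : Set where
    field
      inhabited  : ∃ λ φ → LCol φ × Holds F φ
      equivalent : ∀ {φ ψ} → LCol φ → LCol ψ → Holds F φ → Holds F ψ → φ ∼ ψ
  open Class public

  look-just⁺ : ∀ {F v c} → AllPairs Compatible F → (v , c) ∈ F → look F v ≡ just c
  look-just⁺ {(t , d) ∷ F} {v} _ 0th rewrite dec-true (v ≟F v) refl = refl
  look-just⁺ {(t , d) ∷ F} {v} (h ∷ hs) (there i) with v ≟F t
  ... | yes refl = ⊥-elim (proj₁ (All.lookup h i) refl)
  ... | no _     = look-just⁺ hs i

  compatible-lookup : ∀ {F s t c d} → AllPairs Compatible F → (s , c) ∈ F → (t , d) ∈ F → s ~ t → c ≢ d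
  compatible-lookup (h ∷ hs) 0th 0th a = ⊥-elim (~⇒≢ a refl)
  compatible-lookup (h ∷ hs) 0th (there j) a = proj₂ (All.lookup h j) a
  compatible-lookup (h ∷ hs) (there i) 0th a = proj₂ (All.lookup h i) (~-sym a) ∘ ≡-sym
  compatible-lookup (h ∷ hs) (there i) (there j) a = compatible-lookup hs i j a

  class-of : ∀ {F} → Valid F → (∀ t → t ∉ dom F → ∃ λ s → Waste F s × Walk G (_∉ dom F) t s) → Class F
  class-of {F} V reach = record
    { inhabited  = let (φ , cφ , ag) = proj₁ C in φ , cφ , All.tabulate λ {(t , c)} i → ag t c (look-just⁺ (compatible V) i)
    ; equivalent = λ {φ} {ψ} cφ cψ hφ hψ → proj₂ C φ ψ cφ cψ (agrees hφ) (agrees hψ) }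
    where
    module P = Precoloured G reg L ass (look F)
    waste : ∀ {s} → Waste F s → P.Wasteful s
    waste (inj₁ (t , c , i , a , c∉)) = inj₁ (t , c , a , look-just⁺ (compatible V) i , c∉)
    waste (inj₂ (r , t , c , r≢t , i , j , a , b)) =
      inj₂ (r , t , c , r≢t , a , b , look-just⁺ (compatible V) i , look-just⁺ (compatible V) j)
    agrees : ∀ {φ} → Holds F φ → P.Agrees φ
    agrees h t c e = All.lookup h (look-just⁻ F e)
    C = P.class (λ t c e → All.lookup (member V) (look-just⁻ F e))
      (λ s t c d a e e′ → compatible-lookup (compatible V) (look-just⁻ F e) (look-just⁻ F e′) a)
      (λ t e → let (s , ws , W) = reach t (look-nothing⁻ F e) in s , waste ws , walk-map G (look-nothing⁺ F) W)
      x₀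

  -- By 4-connectivity a single vertex with waste serves every vertex outside the at most three
  -- fixed ones.
  class₃ : ∀ {F} → Valid F → length (dom F) ≤ 3 → ∀ s → s ∉ dom F → Waste F s → Class F
  class₃ {F} V h s s∉ ws = class-of V λ t t∉ → s , ws , walk-avoiding (dom F) h t∉ s∉

  Linked : Precolouring n → Precolouring n → Set
  Linked F F′ = ∀ {φ ψ} → LCol φ → LCol ψ → Holds F φ → Holds F′ ψ → φ ∼ ψ

  linked-sym : ∀ {F F′} → Linked F F′ → Linked F′ F
  linked-sym l cφ cψ hφ hψ = equiv-sym G L (l cψ cφ hψ hφ)

  -- The middle class must be inhabited, since links to an empty class hold vacuously.
  linked-trans : ∀ {F F′ F″} → Class F′ → Linked F F′ → Linked F′ F″ → Linked F F″
  linked-trans C l l′ cφ cψ hφ hψ = let (θ , cθ , hθ) = inhabited C in l cφ cθ hφ hθ ◅◅ l′ cθ cψ hθ hψ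

  meet : ∀ {F F′} → Class F → Class F′ → (∃ λ θ → LCol θ × Holds F θ × Holds F′ θ) → Linked F F′
  meet C C′ (θ , cθ , h , h′) cφ cψ hφ hψ = equivalent C cφ cθ hφ h ◅◅ equivalent C′ cθ cψ h′ hψ

-- Lists that are not all equal

-- If `v` has a non-neighbour, its neighbourhood separates the two and has at least four elements.
-- Otherwise `v` is adjacent to all others, of which there are at least four.
four≤degree : ∀ {n k} (G : Graph n) → Connected 4 G → (∀ v → count (adj G v) ≡ k) → 4 ≤ k
four≤degree {n} {k} G (4<n , conn) reg = ≮⇒≥ few
  where
  v : Fin n
  v = fromℕ< 4<n
  few : ¬ k < 4
  few k<4 with any? (λ u → ¬? (u ≟F v) ×-dec ¬? (adj G v u Boolₚ.≟ true))
  ... | yes (u , u≢v , u≁v) = stuck (conn (toSubset (adj G v)) (≤-trans (s≤s (≤-reflexive (trans (∣toSubset∣ (adj G v)) (reg v)))) k<4) v u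
          (λ i → adj⇒≢ G (∈-toSubset⁻ (adj G v) i) refl) (u≁v ∘ ∈-toSubset⁻ (adj G v)))
    where
    stuck : ¬ PathAvoiding G (toSubset (adj G v)) v u
    stuck (here _) = u≢v refl
    stuck (step _ a (here w∉)) = w∉ (∈-toSubset⁺ (adj G v) a)
    stuck (step _ a (step w∉ _ _)) = w∉ (∈-toSubset⁺ (adj G v) a)
  ... | no none = <⇒≱ (≤-trans (s≤s k<4) 4<n) (≤-trans (≤-reflexive (≡-sym (count-all n)))
          (≤-trans (count≤1+remove (λ _ → true) v) (s≤s (≤-trans (count-mono {p = (λ _ → true) ∖ v} {q = adj G v} near) (≤-reflexive (reg v))))))
    where
    near : ∀ t → ((λ _ → true) ∖ v) t ≡ true → adj G v t ≡ true
    near t e with adj G v t Boolₚ.≟ true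
    ... | yes a = a
    ... | no ¬a = ⊥-elim (none (t , proj₂ (∖-elim (λ _ → true) e) , ¬a))

module Arcs {n : ℕ} (G : Graph n) (connected : Connected 4 G) {k : ℕ}
  (reg : ∀ v → count (adj G v) ≡ k) (L : ListAssignment n) (ass : IsKAssignment k L) where

  open Colourings G connected reg L ass

  4≤k : 4 ≤ k
  4≤k = four≤degree G connected reg

  nbr-avoiding : ∀ u xs → length xs ≤ 3 → ∃ λ t → u ~ t × t ∉ xs
  nbr-avoiding u xs h = pick (adj G u) xs (≤-trans (s≤s h) (≤-trans 4≤k (≤-reflexive (≡-sym (reg u)))))

  Differ : Fin n → Fin n → Set
  Differ r t = ∃ λ e → e ∈ L r × e ∉ L t

  differ? : ∀ r t → Dec (Differ r t)
  differ? r t with Any.any? (λ e → ¬? (e ∈ℕ? L t)) (L r)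
  ... | yes h = let (e , e∈ , e∉) = find h in yes (e , e∈ , e∉)
  ... | no ¬h = no λ (e , e∈ , e∉) → ¬h (lose e∈ e∉)

  ¬differ⇒⊆ : ∀ {r t} → ¬ Differ r t → ∀ {c} → c ∈ L r → c ∈ L t
  ¬differ⇒⊆ {r} {t} h {c} c∈ = decidable-stable (c ∈ℕ? L t) λ c∉ → h (c , c∈ , c∉)

  -- Lists have equal size, so `L t` with `d` added is longer than `L r`; some colour of it is
  -- missing from `L r`, and that colour is not `d`.
  differ-sym : ∀ {r t} → Differ r t → Differ t r
  differ-sym {r} {t} (d , d∈ , d∉)
    with unique-overflow {xs = d ∷ L t} {ys = L r} (All.tabulate (λ {c} c∈ → λ { refl → d∉ c∈ }) ∷ proj₁ (ass t))
           (s≤s (≤-reflexive (trans (proj₂ (ass r)) (≡-sym (proj₂ (ass t))))))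
  ... | c , here refl , c∉ = ⊥-elim (c∉ d∈)
  ... | c , there c∈ , c∉ = c , c∈ , c∉

  differing-edge : ∀ {P : Fin n → Set} {a b} → Walk G P a b → Differ a b →
    ∃ λ r → ∃ λ t → P r × P t × r ~ t × Differ r t
  differing-edge (stop _) (_ , d∈ , d∉) = ⊥-elim (d∉ d∈)
  differing-edge (move {u = u} {w = w} p a W) D@(d , d∈ , d∉) with differ? u w
  ... | yes D′ = u , w , p , walk-start G W , a , D′
  ... | no ¬D  = differing-edge W (d , ¬differ⇒⊆ ¬D d∈ , d∉)

  -- Colouring `u` with `α` costs its neighbour `w` nothing, so `w` has a colour to spare. The class
  -- depends on `u` and `α` only; the tail `w` may be replaced by any other vertex that qualifies.
  record Arc (u : Fin n) (α : ℕ) (w : Fin n) : Set where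
    constructor arc
    field
      edge    : u ~ w
      offers  : α ∈ L u
      refuses : α ∉ L w
  open Arc

  ⟨_,_⟩ : Fin n → ℕ → Precolouring n
  ⟨ u , α ⟩ = (u , α) ∷ []

  arc-class : ∀ {u α w} → Arc u α w → Class ⟨ u , α ⟩
  arc-class {u} {α} {w} A = class₃ (valid (offers A ∷ []) ([] ∷ [])) (s≤s z≤n) w
    (∉-intro ((~⇒≢ (~-sym (edge A))) ∷ [])) (inj₁ (u , α , 0th , ~-sym (edge A) , refuses A))

  infix 4 _≈_
  _≈_ : Fin n × ℕ → Fin n × ℕ → Set
  (u , α) ≈ (w , β) = Linked ⟨ u , α ⟩ ⟨ w , β ⟩

  ≈-sym : ∀ {u α w β} → (u , α) ≈ (w , β) → (w , β) ≈ (u , α)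
  ≈-sym {u} {α} {w} {β} = linked-sym {⟨ u , α ⟩} {⟨ w , β ⟩}

  via : ∀ {u α s d t w β} → Arc s d t → (u , α) ≈ (s , d) → (s , d) ≈ (w , β) → (u , α) ≈ (w , β)
  via {u} {α} {s} {d} {t} {w} {β} A = linked-trans {⟨ u , α ⟩} {⟨ s , d ⟩} {⟨ w , β ⟩} (arc-class A)

  -- Both heads are coloured at once. It is enough that one tail is not the other head, for that
  -- tail stays free and keeps its spare colour.
  direct : ∀ {u α w u′ α′ w′} → Arc u α w → Arc u′ α′ w′ → u ≢ u′ → (u ~ u′ → α ≢ α′) →
    w ≢ u′ ⊎ w′ ≢ u → (u , α) ≈ (u′ , α′)
  direct {u} {α} {w} {u′} {α′} {w′} A A′ u≢u′ c s = meet (arc-class A) (arc-class A′) (split (common s))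
    where
    F : Precolouring n
    F = (u , α) ∷ (u′ , α′) ∷ []
    V : Valid F
    V = valid (offers A ∷ offers A′ ∷ []) (((u≢u′ , c) ∷ []) ∷ [] ∷ [])
    common : w ≢ u′ ⊎ w′ ≢ u → Class F
    common (inj₁ w≢u′) = class₃ V (s≤s (s≤s z≤n)) w (∉-intro (~⇒≢ (~-sym (edge A)) ∷ w≢u′ ∷ []))
      (inj₁ (u , α , 0th , ~-sym (edge A) , refuses A))
    common (inj₂ w′≢u) = class₃ V (s≤s (s≤s z≤n)) w′ (∉-intro (w′≢u ∷ ~⇒≢ (~-sym (edge A′)) ∷ []))
      (inj₁ (u′ , α′ , 1st , ~-sym (edge A′) , refuses A′))
    split : Class F → ∃ λ θ → LCol θ × Holds ⟨ u , α ⟩ θ × Holds ⟨ u′ , α′ ⟩ θ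
    split C with inhabited C
    ... | θ , cθ , h ∷ h′ ∷ [] = θ , cθ , h ∷ [] , h′ ∷ []

  ∈∉⇒≢ : ∀ {c d : ℕ} {xs} → c ∈ xs → d ∉ xs → c ≢ d
  ∈∉⇒≢ i j refl = j i

  -- The lists of u, w, s miss β, α, δ respectively.  Inside the triangle there are two groups of
  -- mutually linked classes; anything outside the triangle that distinguishes lists joins them.
  module Triangle {u w s : Fin n} {α β δ : ℕ} (uw : u ~ w) (us : u ~ s) (sw : s ~ w)
    (αu : α ∈ L u) (αs : α ∈ L s) (αw : α ∉ L w)
    (βw : β ∈ L w) (βs : β ∈ L s) (βu : β ∉ L u)
    (δu : δ ∈ L u) (δw : δ ∈ L w) (δs : δ ∉ L s) where

    α≢β : α ≢ β
    α≢β = ∈∉⇒≢ αu βu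

    A₁ = arc uw αu αw
    A₂ = arc (~-sym us) βs βu
    A₃ = arc (~-sym sw) δw δs
    B₁ = arc (~-sym uw) βw βu
    B₃ = arc sw αs αw

    A₁≈A₂ : (u , α) ≈ (s , β)
    A₁≈A₂ = direct A₁ A₂ (~⇒≢ us) (λ _ → α≢β) (inj₁ (~⇒≢ (~-sym sw)))

    A₁≈A₃ : (u , α) ≈ (w , δ)
    A₁≈A₃ = direct A₁ A₃ (~⇒≢ uw) (λ _ → ∈∉⇒≢ αs δs) (inj₂ (~⇒≢ (~-sym us)))

    B₃≈B₁ : (s , α) ≈ (w , β)
    B₃≈B₁ = direct B₃ B₁ (~⇒≢ sw) (λ _ → α≢β) (inj₂ (~⇒≢ us))

    -- The route runs through `B₃` if `e` differs from `α`. If `e` is `α`, it leaves from `A₂` and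
    -- ends directly at `B₁`, both of colour `β`.
    outside-edge : ∀ {r e t} → Arc r e t → All (r ≢_) (u ∷ w ∷ s ∷ []) → All (t ≢_) (u ∷ w ∷ s ∷ []) → (u , α) ≈ (w , β)
    outside-edge {r} {e} {t} R (r≢u ∷ r≢w ∷ r≢s ∷ []) (t≢u ∷ t≢w ∷ t≢s ∷ []) with e ℕₚ.≟ α
    ... | no e≢α = via R (direct A₁ R (r≢u ∘ ≡-sym) (λ _ → e≢α ∘ ≡-sym) (inj₂ t≢u))
                    (via B₃ (direct R B₃ r≢s (λ _ → e≢α) (inj₁ t≢s)) B₃≈B₁)
    ... | yes refl = via A₂ A₁≈A₂ (via R (direct A₂ R (r≢s ∘ ≡-sym) (λ _ → α≢β ∘ ≡-sym) (inj₂ t≢s))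
                      (direct R B₁ r≢w (λ _ → α≢β) (inj₁ t≢w)))

    outside-nbr : ∀ {t} → u ~ t → t ≢ w → t ≢ s → Differ t u → (u , α) ≈ (w , β)
    outside-nbr {t} ut t≢w t≢s (e , e∈ , e∉) =
      via A₃ A₁≈A₃ (via T (direct A₃ T (t≢w ∘ ≡-sym) (λ _ → ∈∉⇒≢ δu e∉) (inj₂ (~⇒≢ uw)))
        (via B₃ (direct T B₃ t≢s (λ _ → ∈∉⇒≢ αu e∉ ∘ ≡-sym) (inj₁ (~⇒≢ us))) B₃≈B₁))
      where
      T : Arc t e u
      T = arc (~-sym ut) e∈ e∉

  -- If neighbours `t` of `u` and `t′` of `w` outside the triangle have the lists of `u` and `w`,
  -- these lists differ in `α`, so a walk from `t` to `t′` avoiding the triangle crosses an edge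
  -- with different lists.
  triangle : ∀ {u w s α β δ} → u ~ w → u ~ s → s ~ w →
    α ∈ L u → α ∈ L s → α ∉ L w → β ∈ L w → β ∈ L s → β ∉ L u → δ ∈ L u → δ ∈ L w → δ ∉ L s →
    (u , α) ≈ (w , β)
  triangle {u} {w} {s} {α} {β} uw us sw αu αs αw βw βs βu δu δw δs
    with nbr-avoiding u (w ∷ s ∷ u ∷ []) ≤-refl | nbr-avoiding w (u ∷ s ∷ w ∷ []) ≤-refl
  ... | t , ut , t∉ | t′ , wt′ , t′∉ with differ? t u | differ? t′ w
  ...   | yes D | _ = Triangle.outside-nbr uw us sw αu αs αw βw βs βu δu δw δs ut (t∉ ∘ here) (t∉ ∘ there ∘ here) D
  ...   | no _ | yes D = ≈-sym {w} {β} {u} {α} (Triangle.outside-nbr (~-sym uw) (~-sym sw) (~-sym us) βw βs βu αu αs αw δw δu δs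
                           wt′ (t′∉ ∘ here) (t′∉ ∘ there ∘ here) D)
  ...   | no ¬D | no ¬D′ =
    let (r , q , r∉ , q∉ , rq , e , e∈ , e∉) = differing-edge
          (walk-avoiding (u ∷ w ∷ s ∷ []) ≤-refl
            (∉-intro (t∉ ∘ 2ndʳ ∷ (t∉ ∘ here) ∷ (t∉ ∘ there ∘ here) ∷ []))
            (∉-intro ((t′∉ ∘ here) ∷ t′∉ ∘ 2ndʳ ∷ (t′∉ ∘ there ∘ here) ∷ [])))
          (α , ¬differ⇒⊆ (¬D ∘ differ-sym) αu , λ αt′ → αw (¬differ⇒⊆ ¬D′ αt′))
    in Triangle.outside-edge uw us sw αu αs αw βw βs βu δu δw δs (arc rq e∈ e∉) (¬Any⇒All¬ _ r∉) (¬Any⇒All¬ _ q∉)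
    where
    2ndʳ : ∀ {x a b c : Fin n} → x ≡ c → x ∈ a ∷ b ∷ c ∷ []
    2ndʳ e = there (there (here e))

  -- If `s` refuses `α`, it can replace `w` as the tail. Otherwise the arc from `s` to `u` is an
  -- intermediate stop, which fails only if its colour is `β` and `s` is adjacent to `w`. That
  -- leaves a triangle, and a colour `δ` of `u` missing at `s`: if `w` lacks it too, `u` coloured
  -- `δ` is a further stop, and if not, `triangle` applies.
  flip-beside : ∀ {u α w β s} → Arc u α w → Arc w β u → u ~ s → s ≢ w → Differ s u → (u , α) ≈ (w , β)
  flip-beside {u} {α} {w} {β} {s} A B us s≢w D@(d , ds , du) with α ∈ℕ? L s | d ℕₚ.≟ β | s ~? w
  ... | no α∉ | _ | _ = direct (arc us (offers A) α∉) B (~⇒≢ (edge A)) (λ _ → ∈∉⇒≢ (offers A) (refuses B)) (inj₁ s≢w)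
  ... | yes _ | no d≢β | _ = via S (direct A S (~⇒≢ us) (λ _ → ∈∉⇒≢ (offers A) du) (inj₁ (s≢w ∘ ≡-sym)))
                                (direct S B s≢w (λ _ → d≢β) (inj₁ (~⇒≢ (edge A))))
    where S = arc (~-sym us) ds du
  ... | yes _ | yes _ | no s≁w = via S (direct A S (~⇒≢ us) (λ _ → ∈∉⇒≢ (offers A) du) (inj₁ (s≢w ∘ ≡-sym)))
                                (direct S B s≢w (λ a → ⊥-elim (s≁w a)) (inj₁ (~⇒≢ (edge A))))
    where S = arc (~-sym us) ds du
  ... | yes αs | yes refl | yes sw with differ-sym D
  ...   | δ , δu , δs with δ ∈ℕ? L w
  ...     | yes δw = triangle (edge A) us sw (offers A) αs (refuses A) (offers B) ds du δu δw δs
  ...     | no δ∉w = via S (direct A S (~⇒≢ us) (λ _ → ∈∉⇒≢ (offers A) du) (inj₁ (s≢w ∘ ≡-sym)))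
                       (via U (direct S U (~⇒≢ us ∘ ≡-sym) (λ _ → ∈∉⇒≢ δu du ∘ ≡-sym) (inj₂ (s≢w ∘ ≡-sym)))
                         (direct U′ B (~⇒≢ (edge A)) (λ _ → ∈∉⇒≢ δu du) (inj₁ s≢w)))
    where
    S = arc (~-sym us) ds du
    U = arc (edge A) δu δ∉w
    U′ = arc us δu δs

  -- A colour other than `α` and `β` in which the lists of `r` and `t` differ gives an intermediate
  -- stop. Without one, the edge is a copy of `uw`: one end offers `α`, the other `β`, and each
  -- refuses the other's colour.
  flip-apart : ∀ {u α w β r t} → Arc u α w → Arc w β u → r ~ t → Differ r t → r ∉ u ∷ w ∷ [] → t ∉ u ∷ w ∷ [] →
    (u , α) ≈ (w , β) ⊎ ((Arc r α t × Arc t β r) ⊎ (Arc t α r × Arc r β t))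
  flip-apart {u} {α} {w} {β} {r} {t} A B rt D@(e , er , et) r∉ t∉ with differ-sym D
  ... | e′ , e′t , e′r with e ℕₚ.≟ α | e ℕₚ.≟ β | e′ ℕₚ.≟ α | e′ ℕₚ.≟ β
  ...   | no p | no q | _ | _ = inj₁ (via R (direct A R (r∉ ∘ here ∘ ≡-sym) (λ _ → p ∘ ≡-sym) (inj₂ (t∉ ∘ here)))
                                  (direct R B (r∉ ∘ there ∘ here) (λ _ → q) (inj₁ (t∉ ∘ there ∘ here))))
    where R = arc rt er et
  ...   | _ | _ | no p | no q = inj₁ (via R (direct A R (t∉ ∘ here ∘ ≡-sym) (λ _ → p ∘ ≡-sym) (inj₂ (r∉ ∘ here)))
                                  (direct R B (t∉ ∘ there ∘ here) (λ _ → q) (inj₁ (r∉ ∘ there ∘ here))))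
    where R = arc (~-sym rt) e′t e′r
  ...   | yes refl | _ | _ | yes refl = inj₂ (inj₁ (arc rt er et , arc (~-sym rt) e′t e′r))
  ...   | _ | yes refl | yes refl | _ = inj₂ (inj₂ (arc (~-sym rt) e′t e′r , arc rt er et))
  ...   | yes refl | _ | yes refl | _ = ⊥-elim (et e′t)
  ...   | _ | yes refl | _ | yes refl = ⊥-elim (et e′t)

  flip-far : ∀ {u α w β} xs → length xs ≤ 1 → Arc u α w → Arc w β u →
    (u , α) ≈ (w , β) ⊎ (∃ λ s → ∃ λ r → s ∉ u ∷ w ∷ xs × r ∉ u ∷ w ∷ xs × Arc s α r × Arc r β s)
  flip-far {u} {α} {w} {β} xs h A B
    with nbr-avoiding u (u ∷ w ∷ xs) (s≤s (s≤s h)) | nbr-avoiding w (u ∷ w ∷ xs) (s≤s (s≤s h))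
  ... | t , ut , t∉ | t′ , wt′ , t′∉ with differ? t u | differ? t′ w
  ...   | yes D | _ = inj₁ (flip-beside A B ut (t∉ ∘ there ∘ here) D)
  ...   | no _ | yes D = inj₁ (≈-sym {w} {β} {u} {α} (flip-beside B A wt′ (t′∉ ∘ here) D))
  ...   | no ¬D | no ¬D′
    with differing-edge (walk-avoiding (u ∷ w ∷ xs) (s≤s (s≤s h)) t∉ t′∉)
          (α , ¬differ⇒⊆ (¬D ∘ differ-sym) (offers A) , λ αt′ → refuses A (¬differ⇒⊆ ¬D′ αt′))
  ...     | r , q , r∉ , q∉ , rq , D with flip-apart A B rq D (r∉ ∘ shrink) (q∉ ∘ shrink)
    where
    shrink : ∀ {x} → x ∈ u ∷ w ∷ [] → x ∈ u ∷ w ∷ xs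
    shrink (here e) = here e
    shrink (there (here e)) = there (here e)
  ...       | inj₁ l = inj₁ l
  ...       | inj₂ (inj₁ (R , Q)) = inj₂ (r , q , r∉ , q∉ , R , Q)
  ...       | inj₂ (inj₂ (Q , R)) = inj₂ (q , r , q∉ , r∉ , Q , R)

  flip : ∀ {u α w β} → Arc u α w → Arc w β u → (u , α) ≈ (w , β)
  flip {u} {α} {w} {β} A B with flip-far [] z≤n A B
  ... | inj₁ l = l
  ... | inj₂ (s , r , s∉ , r∉ , S , R) with flip-far (s ∷ []) ≤-refl A B
  ...   | inj₁ l = l
  ...   | inj₂ (s₂ , r₂ , s₂∉ , r₂∉ , S₂ , R₂) =
    -- One copy of `uw` is not enough, because passing from one of its ends to the other would be a
    -- flip again. With a second copy avoiding `s`, the route alternates between the copies and the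
    -- colours.
    via R₂ (direct A R₂ (r₂∉ ∘ here ∘ ≡-sym) (λ _ → α≢β) (inj₂ (s₂∉ ∘ here)))
      (via S (direct R₂ S (r₂∉ ∘ there ∘ there ∘ here) (λ _ → α≢β ∘ ≡-sym) (inj₁ (s₂∉ ∘ there ∘ there ∘ here)))
        (direct S B (s∉ ∘ there ∘ here) (λ _ → α≢β) (inj₂ (s∉ ∘ here ∘ ≡-sym))))
    where
    α≢β : α ≢ β
    α≢β = ∈∉⇒≢ (offers A) (refuses B)

  reverse-arc : ∀ {u α w} → Arc u α w → ∃ λ β → Arc w β u
  reverse-arc {u} {α} {w} A = let (β , βw , βu) = differ-sym (α , offers A , refuses A) in
    β , arc (~-sym (edge A)) βw βu

  -- Equal heads, opposite arcs and equal colours are the cases outside the reach of `direct`.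
  -- Reversing the first arc changes head and colour together, and `flip` pays for it.
  arcs-linked : ∀ {u α w u′ α′ w′} → Arc u α w → Arc u′ α′ w′ → (u , α) ≈ (u′ , α′)
  arcs-linked {u} {α} {w} {u′} {α′} {w′} A A′ with reverse-arc A
  ... | β , B with u′ ≟F u | u′ ≟F w | w′ ≟F w | w′ ≟F u | α ℕₚ.≟ α′
  ...   | yes refl | _ | yes refl | _ | _ = via B (flip A B) (flip B A′)
  ...   | yes refl | _ | no w′≢w | _ | _ = via B (flip A B)
            (direct B A′ (~⇒≢ (edge B)) (λ _ → ∈∉⇒≢ (offers A′) (refuses B) ∘ ≡-sym) (inj₂ w′≢w))
  ...   | no _ | yes refl | _ | yes refl | _ = flip A A′
  ...   | no _ | yes refl | _ | no w′≢u | _ = direct A A′ (~⇒≢ (edge A)) (λ _ → ∈∉⇒≢ (offers A′) (refuses A) ∘ ≡-sym) (inj₂ w′≢u)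
  ...   | no u′≢u | no u′≢w | _ | _ | no α≢α′ = direct A A′ (u′≢u ∘ ≡-sym) (λ _ → α≢α′) (inj₁ (u′≢w ∘ ≡-sym))
  ...   | no u′≢u | no u′≢w | _ | _ | yes refl = via B (flip A B)
            (direct B A′ (u′≢w ∘ ≡-sym) (λ _ → ∈∉⇒≢ (offers A) (refuses B) ∘ ≡-sym) (inj₁ (u′≢u ∘ ≡-sym)))

  -- From an arbitrary colouring to an arc

  IntoArc : Colouring n → Set
  IntoArc φ = ∃ λ r → ∃ λ e → ∃ λ t → Arc r e t × (∃ λ θ → LCol θ × θ r ≡ e × φ ∼ θ)

  -- Fixing `x` and `y` alike wastes a colour at `u`, and this remains so when `r` is fixed as well.
  -- So `r` can be given the colour `e` without leaving the class of the pair.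
  pair-meets-arc : ∀ {φ u x y r e t} → LCol φ → x ≢ y → u ~ x → u ~ y → φ x ≡ φ y →
    Arc r e t → r ∉ x ∷ y ∷ u ∷ [] → e ≢ φ x → IntoArc φ
  pair-meets-arc {φ} {u} {x} {y} {r} {e} {t} cφ x≢y ux uy φx≡φy R r∉ e≢ = finish (inhabited C₃)
    where
    x≁y : ¬ x ~ y
    x≁y a = proj₁ cφ x y a φx≡φy
    cy : φ x ∈ L y
    cy = subst (_∈ L y) (≡-sym φx≡φy) (proj₂ cφ y)
    C₂ : Class ((x , φ x) ∷ (y , φ x) ∷ [])
    C₂ = class₃ (valid (proj₂ cφ x ∷ cy ∷ []) (((x≢y , λ a → ⊥-elim (x≁y a)) ∷ []) ∷ [] ∷ [])) (s≤s (s≤s z≤n)) u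
      (∉-intro (~⇒≢ ux ∷ ~⇒≢ uy ∷ [])) (inj₂ (x , y , φ x , x≢y , 0th , 1st , ux , uy))
    C₃ : Class ((x , φ x) ∷ (y , φ x) ∷ (r , e) ∷ [])
    C₃ = class₃ (valid (proj₂ cφ x ∷ cy ∷ offers R ∷ [])
        (((x≢y , λ a → ⊥-elim (x≁y a)) ∷ ((r∉ ∘ here ∘ ≡-sym) , λ _ → e≢ ∘ ≡-sym) ∷ [])
          ∷ (((r∉ ∘ there ∘ here ∘ ≡-sym) , λ _ → e≢ ∘ ≡-sym) ∷ []) ∷ [] ∷ [])) ≤-refl u
      (∉-intro (~⇒≢ ux ∷ ~⇒≢ uy ∷ (r∉ ∘ there ∘ there ∘ here ∘ ≡-sym) ∷ []))
      (inj₂ (x , y , φ x , x≢y , 0th , 1st , ux , uy))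
    finish : (∃ λ θ → LCol θ × Holds ((x , φ x) ∷ (y , φ x) ∷ (r , e) ∷ []) θ) → IntoArc φ
    finish (θ , cθ , hx ∷ hy ∷ hr ∷ []) =
      r , e , t , R , θ , cθ , hr , equivalent C₂ cφ cθ (refl ∷ ≡-sym φx≡φy ∷ []) (hx ∷ hy ∷ [])

  -- Since `w` belongs to the pair, the edge `uw` cannot supply the arc. Another is sought with its
  -- head off `w`, `y`, `u`; on a distant edge with different lists, one of the two directions has a
  -- colour other than `φ w`.
  pair-into-arc : ∀ {φ u w y} → LCol φ → Differ u w → u ~ w → u ~ y → w ≢ y → φ w ≡ φ y → φ w ∈ L u → IntoArc φ
  pair-into-arc {φ} {u} {w} {y} cφ (α , αu , αw) uw uy w≢y e c∈u
    with nbr-avoiding u (w ∷ y ∷ u ∷ []) ≤-refl | nbr-avoiding w (w ∷ y ∷ u ∷ []) ≤-refl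
  ... | t , ut , t∉ | t′ , wt′ , t′∉ with differ? t u | differ? t′ w
  ...   | yes (d , dt , du) | _ = pair-meets-arc cφ w≢y uw uy e (arc (~-sym ut) dt du) t∉ (∈∉⇒≢ c∈u du ∘ ≡-sym)
  ...   | no _ | yes (d , dt , dw) = pair-meets-arc cφ w≢y uw uy e (arc (~-sym wt′) dt dw) t′∉ (∈∉⇒≢ (proj₂ cφ w) dw ∘ ≡-sym)
  ...   | no ¬D | no ¬D′
    with differing-edge (walk-avoiding (w ∷ y ∷ u ∷ []) ≤-refl t∉ t′∉)
          (α , ¬differ⇒⊆ (¬D ∘ differ-sym) αu , λ αt′ → αw (¬differ⇒⊆ ¬D′ αt′))
  ...     | r , q , r∉ , q∉ , rq , D@(d , dr , dq) with d ℕₚ.≟ φ w | differ-sym D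
  ...       | no d≢ | _ = pair-meets-arc cφ w≢y uw uy e (arc rq dr dq) r∉ d≢
  ...       | yes refl | d′ , d′q , d′r = pair-meets-arc cφ w≢y uw uy e (arc (~-sym rq) d′q d′r) q∉ (∈∉⇒≢ dr d′r ∘ ≡-sym)

  -- The `k` neighbours of `v` avoid `φ v`, which leaves them only `k - 1` colours of its list.
  waste-at : ∀ {φ} → LCol φ → ∀ v → (∃ λ t → v ~ t × φ t ∉ L v) ⊎
    (∃ λ s → ∃ λ t → s ≢ t × v ~ s × v ~ t × φ s ≡ φ t × φ s ∈ L v)
  waste-at {φ} cφ v with collision φ (adj G v) (filter (¬? ∘ (ℕₚ._≟ φ v)) (L v)) room
    where
    room : length (filter (¬? ∘ (ℕₚ._≟ φ v)) (L v)) < count (adj G v)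
    room = ≤-trans (ℕₚ.+-monoˡ-≤ (length (filter (¬? ∘ (ℕₚ._≟ φ v)) (L v))) (hit (∈-filter⁺ (ℕₚ._≟ φ v) (proj₂ cφ v) refl)))
      (≤-reflexive (trans (≡-sym (length-filter-split (ℕₚ._≟ φ v) (L v))) (trans (proj₂ (ass v)) (≡-sym (reg v)))))
      where
      hit : ∀ {x : ℕ} {xs} → x ∈ xs → 1 ≤ length xs
      hit {xs = _ ∷ _} _ = s≤s z≤n
  ... | inj₁ (t , a , t∉) = inj₁ (t , a , λ i → t∉ (∈-filter⁺ (¬? ∘ (ℕₚ._≟ φ v)) i λ e → proj₁ cφ v t a (≡-sym e)))
  ... | inj₂ (s , t , s≢t , a , b , e) with φ s ∈ℕ? L v
  ...   | yes i = inj₂ (s , t , s≢t , a , b , e , i)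
  ...   | no i  = inj₁ (s , a , i)

  into-arc : ∀ {φ u w} → LCol φ → u ~ w → Differ u w → IntoArc φ
  into-arc {φ} {u} {w} cφ uw D with waste-at cφ u
  ... | inj₁ (t , a , t∉) = t , φ t , u , arc (~-sym a) (proj₂ cφ t) t∉ , φ , cφ , refl , ε
  ... | inj₂ (x , y , x≢y , ux , uy , e , c∈) with x ≟F w | y ≟F w
  ...   | yes refl | _ = pair-into-arc cφ D uw uy x≢y e c∈
  ...   | no _ | yes refl = pair-into-arc cφ D uw ux (x≢y ∘ ≡-sym) (≡-sym e) (subst (_∈ L u) e c∈)
  ...   | no x≢w | no y≢w = let (β , βw , βu) = differ-sym D in
          pair-meets-arc cφ x≢y ux uy e (arc (~-sym uw) βw βu)
            (∉-intro ((x≢w ∘ ≡-sym) ∷ (y≢w ∘ ≡-sym) ∷ ~⇒≢ (~-sym uw) ∷ [])) (∈∉⇒≢ c∈ βu ∘ ≡-sym)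

  differing⇒swappable : ∀ {u w} → u ~ w → Differ u w → LSwappable G L
  differing⇒swappable {u} {w} uw D@(α , αu , αw) =
    (let (φ , cφ , _) = inhabited (arc-class (arc uw αu αw)) in φ , cφ) , λ φ ψ cφ cψ →
      let (r , e , t , R , θ , cθ , hθ , φ∼θ) = into-arc cφ uw D
          (r′ , e′ , t′ , R′ , θ′ , cθ′ , hθ′ , ψ∼θ′) = into-arc cψ uw D
      in φ∼θ ◅◅ (arcs-linked R R′ cθ cθ′ (hθ ∷ []) (hθ′ ∷ []) ◅◅ equiv-sym G L ψ∼θ′)

  lists-differ⇒swappable : ∀ {u w} → Differ u w → LSwappable G L
  lists-differ⇒swappable D =
    let (r , t , _ , _ , rt , D′) = differing-edge (walk-avoiding [] z≤n (λ ()) (λ ())) D in differing⇒swappable rt D′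

-- Lists that are all equal

all-or-some : ∀ {n} {A : Fin n → Set} {B : Set} → (∀ c → A c ⊎ B) → (∀ c → A c) ⊎ B
all-or-some {zero}  h = inj₁ λ ()
all-or-some {suc n} h with h zero | all-or-some (h ∘ suc)
... | inj₂ b | _      = inj₂ b
... | inj₁ _ | inj₂ b = inj₂ b
... | inj₁ a | inj₁ f = inj₁ λ { zero → a ; (suc c) → f c }

module _ {n : ℕ} (G : Graph n) where

  record Component (ok : Fin n → Bool) (c₀ : Fin n) : Set where
    field
      set     : Fin n → Bool
      inside  : ∀ t → set t ≡ true → ok t ≡ true
      root    : set c₀ ≡ true
      saturated : ∀ s t → set s ≡ true → Adj G s t → ok t ≡ true → set t ≡ true
      joined  : ∀ t → set t ≡ true → Walk G (λ x → set x ≡ true) c₀ t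

  component : ∀ ok c₀ → ok c₀ ≡ true → Component ok c₀
  component ok c₀ okc = grow _ (λ t → does (t ≟F c₀)) (λ t e → subst (λ x → ok x ≡ true) (≡-sym (only e)) okc)
      (dec-true (c₀ ≟F c₀) refl) (λ t e → subst (Walk G _ c₀) (≡-sym (only e)) (stop (dec-true (c₀ ≟F c₀) refl))) ≤-refl
    where
    only : ∀ {t} → does (t ≟F c₀) ≡ true → t ≡ c₀
    only {t} = dec-true⁻ (t ≟F c₀)
    grow : ∀ m (C : Fin n → Bool) → (∀ t → C t ≡ true → ok t ≡ true) → C c₀ ≡ true →
      (∀ t → C t ≡ true → Walk G (λ x → C x ≡ true) c₀ t) → count (not ∘ C) ≤ m → Component ok c₀
    grow m C in′ rt jn h
      with any? (λ s → any? (λ t → (C s Boolₚ.≟ true) ×-dec (adj G s t Boolₚ.≟ true) ×-dec (ok t Boolₚ.≟ true) ×-dec (not (C t) Boolₚ.≟ true)))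
    ... | no none = record { set = C ; inside = in′ ; root = rt ; joined = jn ; saturated = λ s t cs a o →
            decidable-stable (C t Boolₚ.≟ true) λ ¬ct → none (s , t , cs , a , o , cong not (≢true⇒false ¬ct)) }
    grow zero C in′ rt jn h | yes (s , t , cs , a , o , ¬ct) =
      ⊥-elim (<⇒≱ (s≤s z≤n) (subst (_≤ 0) (count-remove (not ∘ C) ¬ct) h))
    grow (suc m) C in′ rt jn h | yes (s , t , cs , a , o , ¬ct) = grow m C⁺ in⁺ (old rt) jn⁺
        (s≤s⁻¹ (≤-trans (s≤s (count-mono {p = not ∘ C⁺} {q = (not ∘ C) ∖ t} less)) (subst (_≤ suc m) (count-remove (not ∘ C) ¬ct) h)))
      where
      C⁺ : Fin n → Bool
      C⁺ x = C x ∨ does (x ≟F t)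
      old : ∀ {x} → C x ≡ true → C⁺ x ≡ true
      old e rewrite e = refl
      new : C⁺ t ≡ true
      new rewrite dec-true (t ≟F t) refl = Boolₚ.∨-zeroʳ (C t)
      case⁺ : ∀ {x} → C⁺ x ≡ true → C x ≡ true ⊎ x ≡ t
      case⁺ {x} e with C x | x ≟F t
      ... | true  | _     = inj₁ refl
      ... | false | yes p = inj₂ p
      in⁺ : ∀ x → C⁺ x ≡ true → ok x ≡ true
      in⁺ x e with case⁺ {x} e
      ... | inj₁ p = in′ x p
      ... | inj₂ refl = o
      jn⁺ : ∀ x → C⁺ x ≡ true → Walk G (λ y → C⁺ y ≡ true) c₀ x
      jn⁺ x e with case⁺ {x} e
      ... | inj₁ p = walk-map G old (jn x p)
      ... | inj₂ refl = walk-++ G (walk-map G old (jn s cs)) (move (old cs) a (stop new))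
      less : ∀ x → not (C⁺ x) ≡ true → ((not ∘ C) ∖ t) x ≡ true
      less x e with C x | x ≟F t
      ... | false | no _ = refl

-- Pairs of vertices coloured alike

module Pairs {n : ℕ} (G : Graph n) (connected : Connected 4 G) {k : ℕ}
  (reg : ∀ v → count (adj G v) ≡ k) (L : ListAssignment n) (ass : IsKAssignment k L)
  (same : ∀ r t {c} → c ∈ L r → c ∈ L t) where

  open Colourings G connected reg L ass public
  open Arcs G connected reg L ass using (4≤k; nbr-avoiding; waste-at) public

  kempe : ∀ {φ u c} → LCol φ → c ∈ L u → c ≢ φ u →
    ∃ λ ψ → LCol ψ × Exchange G φ (φ u) c u ψ
  kempe {φ} {u} {c} cφ c∈ c≢ = ψ , (exchange-proper G X (proj₁ cφ) , member) , X
    where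
    a : ℕ
    a = φ u
    ok : Fin n → Bool
    ok t = does (inPair? a c (φ t))
    ok⁻ : ∀ {t} → ok t ≡ true → InPair a c (φ t)
    ok⁻ {t} = dec-true⁻ (inPair? a c (φ t))
    module C = Component (component G ok u (dec-true (inPair? a c (φ u)) (inj₁ refl)))
    other : ℕ → ℕ
    other d with d ℕₚ.≟ a
    ... | yes _ = c
    ... | no _  = a
    other-swaps : ∀ {d} → InPair a c d → swapColour a c d (other d)
    other-swaps {d} p with d ℕₚ.≟ a
    other-swaps p        | yes e = inj₁ (e , refl)
    other-swaps (inj₁ p) | no e  = ⊥-elim (e p)
    other-swaps (inj₂ p) | no e  = inj₂ (p , refl)
    ψ : Colouring n
    ψ t = if C.set t then other (φ t) else φ t
    in-set : ∀ {t} → φ t ≢ ψ t → C.set t ≡ true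
    in-set {t} h with C.set t
    ... | true  = refl
    ... | false = ⊥-elim (h refl)
    swapped : ∀ {t} → C.set t ≡ true → swapColour a c (φ t) (ψ t)
    swapped {t} e = subst (λ b → swapColour a c (φ t) (if b then other (φ t) else φ t)) (≡-sym e)
      (other-swaps (ok⁻ (C.inside t e)))
    to-path : ∀ {s t} → Walk G (λ x → C.set x ≡ true) s t → ABPath G φ a c s t
    to-path (stop p)     = here (ok⁻ (C.inside _ p))
    to-path (move p b r) = step (ok⁻ (C.inside _ p)) b (to-path r)
    X : Exchange G φ a c u ψ
    X = record
      { start  = swapColour-≢ (c≢ ∘ ≡-sym) (swapped C.root)
      ; swaps  = λ t h → swapped (in-set h)
      ; closed = λ s t h b q → swapColour-≢ (c≢ ∘ ≡-sym)
          (swapped (C.saturated s t (in-set h) b (dec-true (inPair? a c (φ t)) q)))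
      ; joined = λ t h ¬r → ¬r (to-path (C.joined t (in-set h))) }
    member : ∀ t → ψ t ∈ L t
    member t with C.set t in e
    ... | false = proj₂ cφ t
    ... | true with φ t ℕₚ.≟ a
    ...   | yes _ = same u t c∈
    ...   | no _  = same u t (proj₂ cφ u)

  -- Makes the common colour of a pair immaterial: a class is determined by `φ x ≡ φ y` alone. If
  -- the swap at `x` does not carry `y` along, a second swap is made at `y`.
  recolour-pair : ∀ {φ x y c} → LCol φ → φ x ≡ φ y → c ∈ L x → ∃ λ ψ → LCol ψ × φ ∼ ψ × ψ x ≡ c × ψ y ≡ c
  recolour-pair {φ} {x} {y} {c} cφ e c∈ with c ℕₚ.≟ φ x
  ... | yes refl = φ , cφ , ε , refl , ≡-sym e
  ... | no c≢ with kempe cφ c∈ c≢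
  ...   | ψ , cψ , X with φ y ℕₚ.≟ ψ y
  ...     | no ch = ψ , cψ , exchange⇒equiv G L cφ cψ X , to (swaps X x (start X)) refl , to (swaps X y ch) (≡-sym e)
    where
    to : ∀ {d d′} → swapColour (φ x) c d d′ → d ≡ φ x → d′ ≡ c
    to (inj₁ (_ , q)) _ = q
    to (inj₂ (p , _)) q = ⊥-elim (c≢ (trans (≡-sym p) q))
  ...     | yes ey with kempe {ψ} {y} {c} cψ (same x y c∈) (λ q → c≢ (trans q (trans (≡-sym ey) (≡-sym e))))
  ...       | θ , cθ , Y = θ , cθ , exchange⇒equiv G L cφ cψ X ◅◅ exchange⇒equiv G L cψ cθ Y ,
                trans (≡-sym x-kept) (to (swaps X x (start X)) refl) , toθ (swaps Y y (start Y))
    where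
    ψy : ψ y ≡ φ x
    ψy = trans (≡-sym ey) (≡-sym e)
    to : ∀ {d d′} → swapColour (φ x) c d d′ → d ≡ φ x → d′ ≡ c
    to (inj₁ (_ , q)) _ = q
    to (inj₂ (p , _)) q = ⊥-elim (c≢ (trans (≡-sym p) q))
    toθ : swapColour (ψ y) c (ψ y) (θ y) → θ y ≡ c
    toθ (inj₁ (_ , q)) = q
    toθ (inj₂ (p , _)) = ⊥-elim (c≢ (trans (≡-sym p) ψy))
    -- x and y lie in different components, as y kept its colour in the first swap.
    x-kept : ψ x ≡ θ x
    x-kept = decidable-stable (ψ x ℕₚ.≟ θ x) λ ch → joined Y x ch λ r →
      exchange-along G (exchange-sym G X)
        (abPath-reverse G (subst (λ d → ABPath G ψ d c y x) ψy r)) (start X ∘ ≡-sym) (≡-sym ey)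

  record Pair (x y v : Fin n) : Set where
    constructor pair
    field
      apart    : x ≢ y
      nonadj   : ¬ x ~ y
      nbr₁     : v ~ x
      nbr₂     : v ~ y
  open Pair public

  pair-swap : ∀ {x y v} → Pair x y v → Pair y x v
  pair-swap (pair a b c d) = pair (a ∘ ≡-sym) (b ∘ ~-sym) d c

  PLinked : Fin n → Fin n → Fin n → Fin n → Set
  PLinked x y z t = ∀ {φ ψ} → LCol φ → LCol ψ → φ x ≡ φ y → ψ z ≡ ψ t → φ ∼ ψ

  plinked-sym : ∀ {x y z t} → PLinked x y z t → PLinked z t x y
  plinked-sym l cφ cψ e e′ = equiv-sym G L (l cψ cφ e′ e)

  plinked-swap : ∀ {x y z t} → PLinked x y z t → PLinked y x z t
  plinked-swap l cφ cψ e e′ = l cφ cψ (≡-sym e) e′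

  palette : ∃ λ a → ∃ λ b → a ≢ b × (∀ t → a ∈ L t) × (∀ t → b ∈ L t)
  palette with L x₀ | proj₁ (ass x₀) | ≤-trans 4≤k (≤-reflexive (≡-sym (proj₂ (ass x₀)))) | (λ t {c} → same x₀ t {c})
  ... | a ∷ b ∷ _ | (a≢b ∷ _) ∷ _ | _ | s = a , b , a≢b , (λ t → s t 0th) , (λ t → s t 1st)
  ... | _ ∷ [] | _ | s≤s () | _

  colA colB : ℕ
  colA = proj₁ palette
  colB = proj₁ (proj₂ palette)

  A≢B : colA ≢ colB
  A≢B = proj₁ (proj₂ (proj₂ palette))

  A∈ : ∀ t → colA ∈ L t
  A∈ = proj₁ (proj₂ (proj₂ (proj₂ palette)))

  B∈ : ∀ t → colB ∈ L t
  B∈ = proj₂ (proj₂ (proj₂ (proj₂ palette)))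

  pair-class : ∀ {x y v} → Pair x y v → Class ((x , colA) ∷ (y , colA) ∷ [])
  pair-class {x} {y} {v} p = class₃ (valid (A∈ x ∷ A∈ y ∷ []) (((apart p , λ a → ⊥-elim (nonadj p a)) ∷ []) ∷ [] ∷ []))
    (s≤s (s≤s z≤n)) v (∉-intro (~⇒≢ (nbr₁ p) ∷ ~⇒≢ (nbr₂ p) ∷ []))
    (inj₂ (x , y , colA , apart p , 0th , 1st , nbr₁ p , nbr₂ p))

  pair-self : ∀ {x y v} → Pair x y v → PLinked x y x y
  pair-self {x} p cφ cψ e e′ =
    let (φ′ , cφ′ , φ∼φ′ , hx , hy) = recolour-pair cφ e (A∈ x)
        (ψ′ , cψ′ , ψ∼ψ′ , gx , gy) = recolour-pair cψ e′ (A∈ x)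
    in φ∼φ′ ◅◅ (equivalent (pair-class p) cφ′ cψ′ (hx ∷ hy ∷ []) (gx ∷ gy ∷ []) ◅◅ equiv-sym G L ψ∼ψ′)

  plinked-via : ∀ {x y z t r s v} → Pair z t v → PLinked x y z t → PLinked z t r s → PLinked x y r s
  plinked-via {z = z} {t} p l l′ cφ cψ e e′ = go (inhabited (pair-class p))
    where
    go : (∃ λ θ → LCol θ × Holds ((z , colA) ∷ (t , colA) ∷ []) θ) → _
    go (θ , cθ , h ∷ h′ ∷ []) = l cφ cθ e (trans h (≡-sym h′)) ◅◅ l′ cθ cψ (trans h (≡-sym h′)) e′

  pmeet : ∀ {x y z t v w} → Pair x y v → Pair z t w → (∃ λ θ → LCol θ × θ x ≡ θ y × θ z ≡ θ t) → PLinked x y z t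
  pmeet p q (θ , cθ , h , h′) cφ cψ e e′ = pair-self p cφ cθ e h ◅◅ pair-self q cθ cψ h′ e′

  triple : ∀ {x y r v w} → Pair x y v → Pair x r w → y ≢ r → ¬ y ~ r → PLinked x y x r
  triple {x} {y} {r} {v} {w} p q y≢r y≁r = pmeet p q (go (inhabited C))
    where
    C : Class ((x , colA) ∷ (y , colA) ∷ (r , colA) ∷ [])
    C = class₃ (valid (A∈ x ∷ A∈ y ∷ A∈ r ∷ [])
        (((apart p , λ a → ⊥-elim (nonadj p a)) ∷ (apart q , λ a → ⊥-elim (nonadj q a)) ∷ [])
          ∷ ((y≢r , λ a → ⊥-elim (y≁r a)) ∷ []) ∷ [] ∷ [])) ≤-refl v
      (∉-intro (~⇒≢ (nbr₁ p) ∷ ~⇒≢ (nbr₂ p) ∷ (λ { refl → nonadj q (~-sym (nbr₁ p)) }) ∷ []))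
      (inj₂ (x , y , colA , apart p , 0th , 1st , nbr₁ p , nbr₂ p))
    go : (∃ λ θ → LCol θ × Holds ((x , colA) ∷ (y , colA) ∷ (r , colA) ∷ []) θ) →
      ∃ λ θ → LCol θ × θ x ≡ θ y × θ x ≡ θ r
    go (θ , cθ , hx ∷ hy ∷ hr ∷ []) = θ , cθ , trans hx (≡-sym hy) , trans hx (≡-sym hr)

  Good : (x y z t s : Fin n) → Set
  Good x y z t s = (s ~ x × s ~ y) ⊎ (s ~ z × s ~ t)

  -- With four vertices fixed, 4-connectivity no longer provides these walks.
  Reaching : (x y z t : Fin n) → Set
  Reaching x y z t = ∀ c → c ∉ x ∷ y ∷ z ∷ t ∷ [] → ∃ λ s → Good x y z t s × Walk G (_∉ x ∷ y ∷ z ∷ t ∷ []) c s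

  reaching⇒plinked : ∀ {x y z t v w} → Pair x y v → Pair z t w → x ≢ z → x ≢ t → y ≢ z → y ≢ t →
    Reaching x y z t → PLinked x y z t
  reaching⇒plinked {x} {y} {z} {t} p q x≢z x≢t y≢z y≢t R = pmeet p q (go (inhabited C))
    where
    F : Precolouring n
    F = (x , colA) ∷ (y , colA) ∷ (z , colB) ∷ (t , colB) ∷ []
    waste : ∀ {s} → Good x y z t s → Waste F s
    waste (inj₁ (a , b)) = inj₂ (x , y , colA , apart p , 0th , 1st , a , b)
    waste (inj₂ (a , b)) = inj₂ (z , t , colB , apart q , 2nd , 3rd , a , b)
    C : Class F
    C = class-of (valid (A∈ x ∷ A∈ y ∷ B∈ z ∷ B∈ t ∷ [])
        (((apart p , λ a → ⊥-elim (nonadj p a)) ∷ (x≢z , λ _ → A≢B) ∷ (x≢t , λ _ → A≢B) ∷ [])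
          ∷ ((y≢z , λ _ → A≢B) ∷ (y≢t , λ _ → A≢B) ∷ []) ∷ ((apart q , λ a → ⊥-elim (nonadj q a)) ∷ []) ∷ [] ∷ []))
      λ c c∉ → let (s , g , W) = R c c∉ in s , waste g , W
    go : (∃ λ θ → LCol θ × Holds F θ) → ∃ λ θ → LCol θ × θ x ≡ θ y × θ z ≡ θ t
    go (θ , cθ , hx ∷ hy ∷ hz ∷ ht ∷ []) = θ , cθ , trans hx (≡-sym hy) , trans hz (≡-sym ht)

-- Linking two disjoint pairs

module Disjoint {n : ℕ} (G : Graph n) (connected : Connected 4 G) {k : ℕ}
  (reg : ∀ v → count (adj G v) ≡ k) (L : ListAssignment n) (ass : IsKAssignment k L)
  (same : ∀ r t {c} → c ∈ L r → c ∈ L t) where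

  open Pairs G connected reg L ass same public

  record Config (x y z t v w : Fin n) : Set where
    field
      P : Pair x y v
      Q : Pair z t w
      x≢z : x ≢ z
      x≢t : x ≢ t
      y≢z : y ≢ z
      y≢t : y ≢ t
      v≢z : v ≢ z
      v≢t : v ≢ t
      w≢x : w ≢ x
      w≢y : w ≢ y

  -- A component of G − {x,y,z,t} without a vertex seeing both x and y, or both z and t: the only
  -- obstruction to colouring G with x, y alike and z, t alike.
  record Stuck (x y z t : Fin n) (C : Fin n → Bool) : Set where
    field
      c₀     : Fin n
      root   : C c₀ ≡ true
      ∌x     : C x ≡ false
      ∌y     : C y ≡ false
      ∌z     : C z ≡ false
      ∌t     : C t ≡ false
      absorbs : ∀ {s q} → C s ≡ true → s ~ q → q ∉ x ∷ y ∷ z ∷ t ∷ [] → C q ≡ true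
      walk   : ∀ {q} → C q ≡ true → Walk G (λ r → C r ≡ true) c₀ q
      ¬xy    : ∀ {s} → C s ≡ true → s ~ x → ¬ s ~ y
      ¬zt    : ∀ {s} → C s ≡ true → s ~ z → ¬ s ~ t

  config-swap : ∀ {x y z t v w} → Config x y z t v w → Config y x z t v w
  config-swap c = record { P = pair-swap P ; Q = Q ; x≢z = y≢z ; x≢t = y≢t ; y≢z = x≢z ; y≢t = x≢t
                         ; v≢z = v≢z ; v≢t = v≢t ; w≢x = w≢y ; w≢y = w≢x }
    where open Config c

  config-flip : ∀ {x y z t v w} → Config x y z t v w → Config z t x y w v
  config-flip c = record { P = Q ; Q = P ; x≢z = x≢z ∘ ≡-sym ; x≢t = y≢z ∘ ≡-sym ; y≢z = x≢t ∘ ≡-sym ; y≢t = y≢t ∘ ≡-sym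
                         ; v≢z = w≢x ; v≢t = w≢y ; w≢x = v≢z ; w≢y = v≢t }
    where open Config c

  stuck-swap : ∀ {x y z t C} → Stuck x y z t C → Stuck y x z t C
  stuck-swap {x} {y} {z} {t} S = record { c₀ = c₀ ; root = root ; ∌x = ∌y ; ∌y = ∌x ; ∌z = ∌z ; ∌t = ∌t
      ; absorbs = λ cs a q∉ → absorbs cs a (q∉ ∘ perm) ; walk = walk ; ¬xy = λ cs a b → ¬xy cs b a ; ¬zt = ¬zt }
    where
    open Stuck S
    perm : ∀ {q} → q ∈ x ∷ y ∷ z ∷ t ∷ [] → q ∈ y ∷ x ∷ z ∷ t ∷ []
    perm (here e) = there (here e)
    perm (there (here e)) = here e
    perm (there (there i)) = there (there i)

  stuck-flip : ∀ {x y z t C} → Stuck x y z t C → Stuck z t x y C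
  stuck-flip {x} {y} {z} {t} S = record { c₀ = c₀ ; root = root ; ∌x = ∌z ; ∌y = ∌t ; ∌z = ∌x ; ∌t = ∌y
      ; absorbs = λ cs a q∉ → absorbs cs a (q∉ ∘ perm) ; walk = walk ; ¬xy = ¬zt ; ¬zt = ¬xy }
    where
    open Stuck S
    perm : ∀ {q} → q ∈ x ∷ y ∷ z ∷ t ∷ [] → q ∈ z ∷ t ∷ x ∷ y ∷ []
    perm (here e) = there (there (here e))
    perm (there (here e)) = there (there (there (here e)))
    perm (there (there (here e))) = here e
    perm (there (there (there (here e)))) = there (here e)

  reaching-or-stuck : ∀ x y z t → Reaching x y z t ⊎ (∃ λ C → Stuck x y z t C)
  reaching-or-stuck x y z t = all-or-some classify
    where
    S : List (Fin n)
    S = x ∷ y ∷ z ∷ t ∷ []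
    good? : ∀ s → Dec (Good x y z t s)
    good? s = ((s ~? x) ×-dec (s ~? y)) ⊎-dec ((s ~? z) ×-dec (s ~? t))
    free : Fin n → Bool
    free q = not (elem S q)
    free⁺ : ∀ {q} → q ∉ S → free q ≡ true
    free⁺ {q} q∉ = cong not (dec-false (q ∈F? S) q∉)
    free⁻ : ∀ {q} → free q ≡ true → q ∉ S
    free⁻ {q} e i = false≢true (trans (≡-sym (cong not (elem⁺ i))) e)
    classify : ∀ c → (c ∉ S → ∃ λ s → Good x y z t s × Walk G (_∉ S) c s) ⊎ (∃ λ C → Stuck x y z t C)
    classify c with c ∈F? S
    ... | yes i = inj₁ λ c∉ → ⊥-elim (c∉ i)
    ... | no c∉ = split
      where
      module K = Component (component G free c (free⁺ c∉))
      out : ∀ {q} → q ∈ S → K.set q ≡ false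
      out i = ≢true⇒false λ e → free⁻ (K.inside _ e) i
      split : (c ∉ S → ∃ λ s → Good x y z t s × Walk G (_∉ S) c s) ⊎ (∃ λ C → Stuck x y z t C)
      split with any? (λ s → (K.set s Boolₚ.≟ true) ×-dec good? s)
      ... | yes (s , ks , g) = inj₁ λ _ → s , g , walk-map G (λ e → free⁻ (K.inside _ e)) (K.joined s ks)
      ... | no none = inj₂ (K.set , record
        { c₀ = c ; root = K.root ; ∌x = out 0th ; ∌y = out 1st ; ∌z = out 2nd ; ∌t = out 3rd
        ; absorbs = λ cs a q∉ → K.saturated _ _ cs a (free⁺ q∉) ; walk = K.joined _
        ; ¬xy = λ {s} cs a b → none (s , cs , inj₁ (a , b)) ; ¬zt = λ {s} cs a b → none (s , cs , inj₂ (a , b)) })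

  clash : ∀ {b} → b ≡ true → b ≡ false → ⊥
  clash refl ()

  in-out≢ : ∀ {C : Fin n → Bool} {s q} → C s ≡ true → C q ≡ false → s ≢ q
  in-out≢ e f refl = false≢true (trans (≡-sym f) e)

  module InStuck {x y z t v w : Fin n} {C : Fin n → Bool} (cfg : Config x y z t v w) (stk : Stuck x y z t C) where

    open Config cfg
    open Stuck stk

    outside-∌ : ∀ {q} → q ∈ x ∷ y ∷ z ∷ t ∷ [] → C q ≡ false
    outside-∌ 0th = ∌x
    outside-∌ 1st = ∌y
    outside-∌ 2nd = ∌z
    outside-∌ 3rd = ∌t

    ∈C⇒∉ : ∀ {s} → C s ≡ true → s ∉ x ∷ y ∷ z ∷ t ∷ []
    ∈C⇒∉ cs i = clash cs (outside-∌ i)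

    w∉C : C w ≡ false
    w∉C = ≢true⇒false λ e → ¬zt e (nbr₁ Q) (nbr₂ Q)

    leave : ∀ {s q} → C s ≡ true → s ~ q → C q ≡ false → q ∈ x ∷ y ∷ z ∷ t ∷ []
    leave {s} {q} cs a cq = decidable-stable (q ∈F? _) λ q∉ → clash (absorbs cs a q∉) cq

    induct : (D : Fin n → Set) → ∀ {c} → C c ≡ true → D c →
      (∀ {s q} → C s ≡ true → C q ≡ true → s ~ q → D s → D q) → ∀ {q} → C q ≡ true → D q
    induct D {c} cc dc cl cq = forward (walk-++ G (walk-reverse G (walk cc)) (walk cq)) dc
      where
      forward : ∀ {s q} → Walk G (λ r → C r ≡ true) s q → D s → D q
      forward (stop _) d = d
      forward (move p a W) d = forward W (cl p (walk-start G W) a d)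

    -- With three of the four cut vertices removed, C is attached to the rest only through e.
    module Exit (a b d e : Fin n) (three : ∀ {q} → q ∈ a ∷ b ∷ d ∷ [] → q ∈ x ∷ y ∷ z ∷ t ∷ [])
      (four : ∀ {q} → q ∈ x ∷ y ∷ z ∷ t ∷ [] → q ∈ a ∷ b ∷ d ∷ [] ⊎ q ≡ e) where

      Clear : Fin n → Set
      Clear q = q ∉ a ∷ b ∷ d ∷ [] × C q ≡ false

      must-exit : ∀ {s q} → C s ≡ true → s ~ q → C q ≡ false → q ∉ a ∷ b ∷ d ∷ [] → q ≡ e
      must-exit cs st cq q∉ with four (leave cs st cq)
      ... | inj₁ i = ⊥-elim (q∉ i)
      ... | inj₂ q≡e = q≡e

      -- G minus `a`, `b`, `d` is connected, so a walk leads from C to `g`, and it can leave C only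
      -- at `e`.
      touch : ∀ {g} → C g ≡ false → g ∉ a ∷ b ∷ d ∷ [] → ∃ λ s → C s ≡ true × s ~ e
      touch cg g∉ = cross (walk-avoiding (a ∷ b ∷ d ∷ []) ≤-refl (∈C⇒∉ root ∘ three) g∉) root cg
        where
        cross : ∀ {p g} → Walk G (_∉ a ∷ b ∷ d ∷ []) p g → C p ≡ true → C g ≡ false → ∃ λ s → C s ≡ true × s ~ e
        cross (stop _) cp cg = ⊥-elim (clash cp cg)
        cross (move {u = p} {w = q} _ pq W) cp cg with C q in cq
        ... | true  = cross W cq cg
        ... | false = p , cp , subst (p ~_) (must-exit cp pq cq (walk-start G W)) pq

      -- Every excursion into C starts and ends at `e`, so it can be cut out of the walk.
      detour : ∀ {p g} → p ∉ a ∷ b ∷ d ∷ [] → C p ≡ false → g ∉ a ∷ b ∷ d ∷ [] → C g ≡ false → Walk G Clear p g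
      detour p∉ cp g∉ cg = proj₁ (go (walk-avoiding (a ∷ b ∷ d ∷ []) ≤-refl p∉ g∉) cg) cp
        where
        go : ∀ {p g} → Walk G (_∉ a ∷ b ∷ d ∷ []) p g → C g ≡ false →
          (C p ≡ false → Walk G Clear p g) × (C p ≡ true → Walk G Clear e g)
        go (stop p) cg = (λ _ → stop (p , cg)) , λ cp → ⊥-elim (clash cp cg)
        go (move {u = p} {w = q} h pq W) cg with C q in cq | go W cg
        ... | false | out , _ = (λ cp → move (h , cp) pq (out refl)) ,
                λ cp → subst (λ r → Walk G Clear r _) (must-exit cp pq cq (walk-start G W)) (out refl)
        ... | true | _ , in′ = (λ cp → subst (λ r → Walk G Clear r _) (≡-sym (must-exit cq (~-sym pq) cp h)) (in′ refl)) ,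
                λ _ → in′ refl

    S : List (Fin n)
    S = x ∷ y ∷ z ∷ t ∷ []

    x-last : ∀ {q} → q ∈ S → q ∈ y ∷ z ∷ t ∷ [] ⊎ q ≡ x
    x-last (here e)  = inj₂ e
    x-last (there i) = inj₁ i

    without-y : ∀ {q} → q ∈ x ∷ z ∷ t ∷ [] → q ∈ S
    without-y (here e)  = here e
    without-y (there i) = there (there i)

    y-last : ∀ {q} → q ∈ S → q ∈ x ∷ z ∷ t ∷ [] ⊎ q ≡ y
    y-last (here e)          = inj₁ (here e)
    y-last (there (here e))  = inj₂ e
    y-last (there (there i)) = inj₁ (there i)

    without-z : ∀ {q} → q ∈ x ∷ y ∷ t ∷ [] → q ∈ S
    without-z (here e)          = here e
    without-z (there (here e))  = there (here e)
    without-z (there (there i)) = there (there (there i))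

    z-last : ∀ {q} → q ∈ S → q ∈ x ∷ y ∷ t ∷ [] ⊎ q ≡ z
    z-last (here e)                  = inj₁ (here e)
    z-last (there (here e))          = inj₁ (there (here e))
    z-last (there (there (here e)))  = inj₂ e
    z-last (there (there (there i))) = inj₁ (there (there i))

    module X = Exit y z t x there x-last
    module Y = Exit x z t y without-y y-last
    module Z = Exit x y t z without-z z-last

    w∉yzt : w ∉ y ∷ z ∷ t ∷ []
    w∉yzt = ∉-intro (w≢y ∷ ~⇒≢ (nbr₁ Q) ∷ ~⇒≢ (nbr₂ Q) ∷ [])

    w∉xzt : w ∉ x ∷ z ∷ t ∷ []
    w∉xzt = ∉-intro (w≢x ∷ ~⇒≢ (nbr₁ Q) ∷ ~⇒≢ (nbr₂ Q) ∷ [])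

    touch-x : ∃ λ s → C s ≡ true × s ~ x
    touch-x = X.touch w∉C w∉yzt

    -- A vertex of `C′` outside C would reach `w` by a detour around C, possibly through the
    -- released `y`. Then `w` would lie in `C′` although it sees both `z` and `t`. Hence `C′` lies
    -- in C, and it misses `c`.
    smaller : ∀ {c C′} → C c ≡ true → Stuck x c z t C′ → count C′ < count C
    smaller {c} {C′} cc S′ = ≤-trans (≤-reflexive (+-comm 1 _))
      (count+length≤count C′ C (c ∷ []) ([] ∷ []) (cc ∷ []) λ q e → sub q e , λ { (here refl) → clash e S′.∌y })
      where
      module S′ = Stuck S′
      follow : ∀ {p g} → Walk G Y.Clear p g → C′ p ≡ true → C′ g ≡ true
      follow (stop _) e = e
      follow (move h a W) e = follow W (S′.absorbs e a (∉-intro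
        ( (λ q≡x → proj₁ (walk-start G W) (here q≡x))
        ∷ (λ { refl → clash cc (proj₂ (walk-start G W)) })
        ∷ (λ q≡z → proj₁ (walk-start G W) (there (here q≡z)))
        ∷ (λ q≡t → proj₁ (walk-start G W) (there (there (here q≡t)))) ∷ [])))
      sub : ∀ q → C′ q ≡ true → C q ≡ true
      sub q e with C q in cq
      ... | true  = refl
      ... | false = ⊥-elim (S′.¬zt (follow (Y.detour
              (∉-intro (in-out≢ e S′.∌x ∷ in-out≢ e S′.∌z ∷ in-out≢ e S′.∌t ∷ [])) cq w∉xzt w∉C) e) (nbr₁ Q) (nbr₂ Q))

    Reducible : Set
    Reducible = ∃ λ s → ∃ λ c → C s ≡ true × C c ≡ true × s ~ c × s ~ x × ¬ c ~ x × ¬ c ~ y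

    reducible? : Dec Reducible
    reducible? = any? λ s → any? λ c → (C s Boolₚ.≟ true) ×-dec (C c Boolₚ.≟ true) ×-dec (s ~? c) ×-dec (s ~? x) ×-dec ¬? (c ~? x) ×-dec ¬? (c ~? y)

    -- The vertices `x`, `y`, `c` are independent and `s` sees `x` and `c`, so `triple` exchanges
    -- {x, y} for {x, c}. Any obstruction that remains is smaller.
    reduce : (∀ {x y z t v w C′} → Config x y z t v w → Stuck x y z t C′ → count C′ < count C → PLinked x y z t) →
      Reducible → PLinked x y z t
    reduce IH (s , c , cs , cc , sc , sx , c≁x , c≁y) =
      plinked-via P′ (triple P P′ (in-out≢ cc ∌y ∘ ≡-sym) (c≁y ∘ ~-sym)) rest
      where
      P′ : Pair x c s
      P′ = pair (in-out≢ cc ∌x ∘ ≡-sym) (c≁x ∘ ~-sym) sx sc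
      cfg′ : Config x c z t s w
      cfg′ = record { P = P′ ; Q = Q ; x≢z = x≢z ; x≢t = x≢t ; y≢z = in-out≢ cc ∌z ; y≢t = in-out≢ cc ∌t
        ; v≢z = in-out≢ cs ∌z ; v≢t = in-out≢ cs ∌t ; w≢x = w≢x ; w≢y = in-out≢ cc w∉C ∘ ≡-sym }
      rest : PLinked x c z t
      rest with reaching-or-stuck x c z t
      ... | inj₁ R = reaching⇒plinked P′ Q x≢z x≢t (in-out≢ cc ∌z) (in-out≢ cc ∌t) R
      ... | inj₂ (C′ , S′) = IH cfg′ S′ (smaller cc S′)

  record Rigid (x y z t v w : Fin n) (C : Fin n → Bool) : Set where
    field
      cfg : Config x y z t v w
      stk : Stuck x y z t C
      xy  : ∀ {s} → C s ≡ true → s ~ x ⊎ s ~ y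
      zt  : ∀ {s} → C s ≡ true → s ~ z ⊎ s ~ t

  rigid-swap : ∀ {x y z t v w C} → Rigid x y z t v w C → Rigid y x z t v w C
  rigid-swap R = record { cfg = config-swap cfg ; stk = stuck-swap stk ; xy = ⊎-swap ∘ xy ; zt = zt }
    where open Rigid R

  rigid-flip : ∀ {x y z t v w C} → Rigid x y z t v w C → Rigid z t x y w v C
  rigid-flip R = record { cfg = config-flip cfg ; stk = stuck-flip stk ; xy = zt ; zt = xy }
    where open Rigid R

  rigid-swapʳ : ∀ {x y z t v w C} → Rigid x y z t v w C → Rigid x y t z v w C
  rigid-swapʳ = rigid-flip ∘ rigid-swap ∘ rigid-flip

  -- Seeing `x` or `y` spreads along the edges of C: the first vertex to see neither would permit a
  -- reduction, with `x` or `y` kept according to what its predecessor sees.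
  irreducible⇒cover : ∀ {x y z t v w C} (cfg : Config x y z t v w) (stk : Stuck x y z t C) →
    ¬ InStuck.Reducible cfg stk → ¬ InStuck.Reducible (config-swap cfg) (stuck-swap stk) →
    ∀ {s} → C s ≡ true → s ~ x ⊎ s ~ y
  irreducible⇒cover {x} {y} {C = C} cfg stk irr irr′ = let (c , cc , cx) = touch-x in induct (λ q → q ~ x ⊎ q ~ y) cc (inj₁ cx) spread
    where
    open InStuck cfg stk
    spread : ∀ {s q} → C s ≡ true → C q ≡ true → s ~ q → s ~ x ⊎ s ~ y → q ~ x ⊎ q ~ y
    spread {s} {q} cs cq a d with q ~? x | q ~? y
    ... | yes h | _ = inj₁ h
    ... | no _ | yes h = inj₂ h
    spread {s} {q} cs cq a (inj₁ sx) | no ¬x | no ¬y = ⊥-elim (irr (s , q , cs , cq , a , sx , ¬x , ¬y))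
    spread {s} {q} cs cq a (inj₂ sy) | no ¬x | no ¬y = ⊥-elim (irr′ (s , q , cs , cq , a , sy , ¬y , ¬x))

  module InRigid {x y z t v w : Fin n} {C : Fin n → Bool} (rig : Rigid x y z t v w C) where

    open Rigid rig
    open InStuck cfg stk
    open Config cfg
    open Stuck stk

    -- With `x` and `y` released, every free vertex of C steps out to one of them, and outside C all
    -- free vertices reach `w` by detours, which never meet `e` or `e′`.
    inner-pair : ∀ {e m e′} → C e ≡ true → C m ≡ true → C e′ ≡ true → e ≢ e′ → ¬ e ~ e′ → m ~ e → m ~ e′ → PLinked e e′ z t
    inner-pair {e} {m} {e′} ce cm ce′ e≢e′ e≁e′ me me′ =
      reaching⇒plinked (pair e≢e′ e≁e′ me me′) Q (in-out≢ ce ∌z) (in-out≢ ce ∌t) (in-out≢ ce′ ∌z) (in-out≢ ce′ ∌t) reaching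
      where
      Free : Fin n → Set
      Free q = q ∉ e ∷ e′ ∷ z ∷ t ∷ []
      free : ∀ {q} → C q ≡ false → q ≢ z → q ≢ t → Free q
      free cq q≢z q≢t = ∉-intro ((in-out≢ ce cq ∘ ≡-sym) ∷ (in-out≢ ce′ cq ∘ ≡-sym) ∷ q≢z ∷ q≢t ∷ [])
      from-x : Walk G Free x w
      from-x = walk-map G (λ (h , c) → free c (h ∘ there ∘ here) (h ∘ there ∘ there ∘ here))
        (X.detour (∉-intro (apart P ∷ x≢z ∷ x≢t ∷ [])) ∌x w∉yzt w∉C)
      from : ∀ {q} → C q ≡ false → q ≢ x → q ≢ z → q ≢ t → Walk G Free q w
      from cq q≢x q≢z q≢t = walk-map G (λ (h , c) → free c (h ∘ there ∘ here) (h ∘ there ∘ there ∘ here))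
        (Y.detour (∉-intro (q≢x ∷ q≢z ∷ q≢t ∷ [])) cq w∉xzt w∉C)
      reaching : Reaching e e′ z t
      reaching q q∉ with C q in cq | q ≟F x
      ... | false | yes refl = w , inj₂ (nbr₁ Q , nbr₂ Q) , from-x
      ... | false | no q≢x = w , inj₂ (nbr₁ Q , nbr₂ Q) , from cq q≢x (q∉ ∘ there ∘ there ∘ here) (q∉ ∘ there ∘ there ∘ there ∘ here)
      ... | true | _ with xy cq
      ...   | inj₁ qx = w , inj₂ (nbr₁ Q , nbr₂ Q) , move q∉ qx from-x
      ...   | inj₂ qy = w , inj₂ (nbr₁ Q , nbr₂ Q) , move q∉ qy (from ∌y (apart P ∘ ≡-sym) y≢z y≢t)

  module Clique {x y z t v w : Fin n} {C : Fin n → Bool} (rig : Rigid x y z t v w C)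
    (clique : ∀ {s q} → C s ≡ true → C q ≡ true → s ≢ q → s ~ q) where

    open Rigid rig
    open InStuck cfg stk public
    open Config cfg public
    open Stuck stk public

    cross-pair : ∀ {c} → C c ≡ true → c ~ x → ∃ λ s → C s ≡ true × Pair y c s
    cross-pair {c} cc cx = let (s , cs , sy) = Y.touch w∉C w∉xzt in
      s , cs , pair (in-out≢ cc ∌y ∘ ≡-sym) (¬xy cc cx ∘ ~-sym) sy (clique cs cc λ { refl → ¬xy cc cx sy })

    -- Now `x` is released. A free vertex of C either steps out to `x` and goes on to `w`, or it
    -- sees `y` and, C being a clique, also `c`.
    cross : ∀ {c} → C c ≡ true → c ~ x → PLinked y c z t
    cross {c} cc cx = let (s , cs , p) = cross-pair cc cx in
      reaching⇒plinked p Q y≢z y≢t (in-out≢ cc ∌z) (in-out≢ cc ∌t) reaching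
      where
      from : ∀ {q} → C q ≡ false → q ≢ y → q ≢ z → q ≢ t → Walk G (_∉ y ∷ c ∷ z ∷ t ∷ []) q w
      from cq q≢y q≢z q≢t = walk-map G
        (λ (h , f) → ∉-intro ((h ∘ here) ∷ (in-out≢ cc f ∘ ≡-sym) ∷ (h ∘ there ∘ here) ∷ (h ∘ there ∘ there ∘ here) ∷ []))
        (X.detour (∉-intro (q≢y ∷ q≢z ∷ q≢t ∷ [])) cq w∉yzt w∉C)
      reaching : Reaching y c z t
      reaching q q∉ with C q in cq
      ... | false = w , inj₂ (nbr₁ Q , nbr₂ Q) , from cq (q∉ ∘ here) (q∉ ∘ there ∘ there ∘ here) (q∉ ∘ there ∘ there ∘ there ∘ here)
      ... | true with xy cq
      ...   | inj₁ qx = w , inj₂ (nbr₁ Q , nbr₂ Q) , move q∉ qx (from ∌x (apart P) x≢z x≢t)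
      ...   | inj₂ qy = q , inj₁ (qy , clique cq cc (q∉ ∘ there ∘ here)) , stop q∉

    -- Here `x` and `z` are released. The vertex `u` sees both `t` and `d`, and outside vertices
    -- reach it through `w` and `x`.
    double-cross : ∀ {c d u} → C c ≡ true → C d ≡ true → C u ≡ true → c ~ x → d ~ z → u ~ x → u ~ t →
      c ≢ d → u ≢ c → u ≢ d → PLinked y c t d
    double-cross {c} {d} {u} cc cd cu cx dz ux ut c≢d u≢c u≢d = let (s , cs , p) = cross-pair cc cx in
      reaching⇒plinked p (pair (in-out≢ cd ∌t ∘ ≡-sym) (¬zt cd dz ∘ ~-sym) ut (clique cu cd u≢d))
        y≢t (in-out≢ cd ∌y ∘ ≡-sym) (in-out≢ cc ∌t) c≢d reaching
      where
      Free : Fin n → Set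
      Free q = q ∉ y ∷ c ∷ t ∷ d ∷ []
      free : ∀ {q} → C q ≡ false → q ≢ y → q ≢ t → Free q
      free cq q≢y q≢t = ∉-intro (q≢y ∷ (in-out≢ cc cq ∘ ≡-sym) ∷ q≢t ∷ (in-out≢ cd cq ∘ ≡-sym) ∷ [])
      good : Good y c t d u
      good = inj₂ (ut , clique cu cd u≢d)
      x⇝u : Walk G Free x u
      x⇝u = move (free ∌x (apart P) x≢t) (~-sym ux) (stop (∉-intro (in-out≢ cu ∌y ∷ u≢c ∷ in-out≢ cu ∌t ∷ u≢d ∷ [])))
      to-w : ∀ {q} → C q ≡ false → q ≢ y → q ≢ z → q ≢ t → Walk G Free q w
      to-w cq q≢y q≢z q≢t = walk-map G (λ (h , f) → free f (h ∘ here) (h ∘ there ∘ there ∘ here))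
        (X.detour (∉-intro (q≢y ∷ q≢z ∷ q≢t ∷ [])) cq w∉yzt w∉C)
      w⇝u : Walk G Free w u
      w⇝u = walk-++ G (walk-reverse G (to-w ∌x (apart P) x≢z x≢t)) x⇝u
      z⇝w : Walk G Free z w
      z⇝w = walk-map G (λ (h , f) → free f (h ∘ there ∘ here) (h ∘ there ∘ there ∘ here))
        (Z.detour (∉-intro ((x≢z ∘ ≡-sym) ∷ (y≢z ∘ ≡-sym) ∷ apart Q ∷ [])) ∌z
          (∉-intro (w≢x ∷ w≢y ∷ ~⇒≢ (nbr₂ Q) ∷ [])) w∉C)
      reaching : Reaching y c t d
      reaching q q∉ with C q in cq | q ≟F z
      ... | false | yes refl = u , good , walk-++ G z⇝w w⇝u
      ... | false | no q≢z = u , good , walk-++ G (to-w cq (q∉ ∘ here) q≢z (q∉ ∘ there ∘ there ∘ here)) w⇝u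
      ... | true | _ with xy cq
      ...   | inj₁ qx = u , good , move q∉ qx x⇝u
      ...   | inj₂ qy = q , inj₁ (qy , clique cq cc (q∉ ∘ there ∘ here)) , stop q∉

  -- The chain is {x, y}, {t, d}, {y, c}, {z, t}: consecutive pairs are disjoint, and each new pair
  -- has one vertex in C.
  rigid-clique-link : ∀ {x y z t v w C} (rig : Rigid x y z t v w C) →
    (clique : ∀ {s q} → C s ≡ true → C q ≡ true → s ≢ q → s ~ q) →
    ∀ {c d u} → C c ≡ true → C d ≡ true → C u ≡ true → c ~ x → d ~ z → u ~ x → u ~ t →
    c ≢ d → u ≢ c → u ≢ d → PLinked x y z t
  rigid-clique-link rig clique {c} {d} {u} cc cd cu cx dz ux ut c≢d u≢c u≢d =
    plinked-via (proj₂ (proj₂ (F.cross-pair cd dz))) (plinked-sym (F.cross cd dz))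
      (plinked-via (proj₂ (proj₂ (E.cross-pair cc cx)))
        (plinked-sym (E.double-cross cc cd cu cx dz ux ut c≢d u≢c u≢d)) (E.cross cc cx))
    where
    module E = Clique rig clique
    module F = Clique (rigid-flip rig) clique

  plinked-swapʳ : ∀ {x y z t} → PLinked x y t z → PLinked x y z t
  plinked-swapʳ l cφ cψ e e′ = l cφ cψ e (≡-sym e′)

  touch-t : ∀ {x y z t v w C} → Rigid x y z t v w C → ∃ λ s → C s ≡ true × s ~ t
  touch-t rig = InStuck.touch-x (Rigid.cfg rig′) (Rigid.stk rig′)
    where rig′ = rigid-swap (rigid-flip rig)

  -- The vertices `s` and `c` become `c` and `u` of the link; the task is to find `d`. If both see
  -- `z`, any vertex of C seeing `t` is distinct from them. Otherwise `m` serves, and its side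
  -- decides which of the two is `u`.
  select : ∀ {x y z t v w C} (rig : Rigid x y z t v w C) →
    (clique : ∀ {s q} → C s ≡ true → C q ≡ true → s ≢ q → s ~ q) →
    ∀ {s c m} → C s ≡ true → C c ≡ true → C m ≡ true → s ≢ c → s ≢ m → c ≢ m → s ~ x → c ~ x → s ~ z →
    c ~ z ⊎ c ~ t → m ~ z ⊎ m ~ t → (∃ λ d → C d ≡ true × d ~ t) → PLinked x y z t
  select rig clique cs cc cm s≢c s≢m c≢m sx cx sz (inj₂ ct) (inj₁ mz) _ =
    rigid-clique-link rig clique cs cm cc sx mz cx ct s≢m (s≢c ∘ ≡-sym) c≢m
  select {x} {y} rig clique cs cc cm s≢c s≢m c≢m sx cx sz (inj₂ ct) (inj₂ mt) _ =
    plinked-swapʳ {x} {y} (rigid-clique-link (rigid-swapʳ rig) clique cc cm cs cx mt sx sz c≢m s≢c s≢m)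
  select {x} {y} rig clique cs cc cm s≢c s≢m c≢m sx cx sz (inj₁ cz) _ (d , cd , dt) =
    plinked-swapʳ {x} {y} (rigid-clique-link (rigid-swapʳ rig) clique cc cd cs cx dt sx sz
      (λ { refl → Stuck.¬zt (Rigid.stk rig) cc cz dt }) s≢c (λ { refl → Stuck.¬zt (Rigid.stk rig) cs sz dt }))

  select-any : ∀ {x y z t v w C} (rig : Rigid x y z t v w C) →
    (clique : ∀ {s q} → C s ≡ true → C q ≡ true → s ≢ q → s ~ q) →
    ∀ {s c m} → C s ≡ true → C c ≡ true → C m ≡ true → s ≢ c → s ≢ m → c ≢ m → s ~ x → c ~ x →
    s ~ z ⊎ s ~ t → PLinked x y z t
  select-any rig clique cs cc cm s≢c s≢m c≢m sx cx (inj₁ sz) =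
    select rig clique cs cc cm s≢c s≢m c≢m sx cx sz (Rigid.zt rig cc) (Rigid.zt rig cm) (touch-t rig)
  select-any {x} {y} rig clique cs cc cm s≢c s≢m c≢m sx cx (inj₂ st) =
    plinked-swapʳ {x} {y} (select rig′ clique cs cc cm s≢c s≢m c≢m sx cx st (Rigid.zt rig′ cc) (Rigid.zt rig′ cm) (touch-t rig′))
    where rig′ = rigid-swapʳ rig

  pigeon-select : ∀ {x y z t v w C} (rig : Rigid x y z t v w C) →
    (clique : ∀ {s q} → C s ≡ true → C q ≡ true → s ≢ q → s ~ q) →
    ∀ {s c m} → C s ≡ true → C c ≡ true → C m ≡ true → s ≢ c → s ≢ m → c ≢ m →
    s ~ x ⊎ s ~ y → c ~ x ⊎ c ~ y → m ~ x ⊎ m ~ y → PLinked x y z t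
  pigeon-select rig cl cs cc cm n₁ n₂ n₃ (inj₁ a) (inj₁ b) _ =
    select-any rig cl cs cc cm n₁ n₂ n₃ a b (Rigid.zt rig cs)
  pigeon-select rig cl cs cc cm n₁ n₂ n₃ (inj₁ a) (inj₂ _) (inj₁ b) =
    select-any rig cl cs cm cc n₂ n₁ (n₃ ∘ ≡-sym) a b (Rigid.zt rig cs)
  pigeon-select rig cl cs cc cm n₁ n₂ n₃ (inj₂ _) (inj₁ a) (inj₁ b) =
    select-any rig cl cc cm cs n₃ (n₁ ∘ ≡-sym) (n₂ ∘ ≡-sym) a b (Rigid.zt rig cc)
  pigeon-select {y = y} rig cl cs cc cm n₁ n₂ n₃ (inj₂ a) (inj₂ b) _ =
    plinked-swap {y} (select-any (rigid-swap rig) cl cs cc cm n₁ n₂ n₃ a b (Rigid.zt rig cs))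
  pigeon-select {y = y} rig cl cs cc cm n₁ n₂ n₃ (inj₂ a) (inj₁ _) (inj₂ b) =
    plinked-swap {y} (select-any (rigid-swap rig) cl cs cm cc n₂ n₁ (n₃ ∘ ≡-sym) a b (Rigid.zt rig cs))
  pigeon-select {y = y} rig cl cs cc cm n₁ n₂ n₃ (inj₁ _) (inj₂ a) (inj₂ b) =
    plinked-swap {y} (select-any (rigid-swap rig) cl cc cm cs n₃ (n₁ ∘ ≡-sym) (n₂ ∘ ≡-sym) a b (Rigid.zt rig cc))

  -- A vertex of C has exactly two neighbours among x, y, z, t, so k ≥ 4 gives C three vertices.
  clique-linked : ∀ {x y z t v w C} (rig : Rigid x y z t v w C) →
    (∀ {s q} → C s ≡ true → C q ≡ true → s ≢ q → s ~ q) → PLinked x y z t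
  clique-linked {x} {y} {z} {t} {C = C} rig clique = finish (nbrs-in (xy root) (zt root))
    where
    open Rigid rig
    open Stuck stk
    absorbed : ∀ {p q r} → p ≡ x ⊎ p ≡ y → q ≡ z ⊎ q ≡ t → c₀ ~ p → c₀ ~ q → c₀ ~ r → r ≢ p → r ≢ q → C r ≡ true
    absorbed {p} {q} {r} hp hq cp cq cr r≢p r≢q = absorbs root cr
      (∉-intro (not-x hp ∷ not-y hp ∷ not-z hq ∷ not-t hq ∷ []))
      where
      not-x : p ≡ x ⊎ p ≡ y → r ≢ x
      not-x (inj₁ refl) = r≢p
      not-x (inj₂ refl) refl = ¬xy root cr cp
      not-y : p ≡ x ⊎ p ≡ y → r ≢ y
      not-y (inj₁ refl) refl = ¬xy root cp cr
      not-y (inj₂ refl) = r≢p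
      not-z : q ≡ z ⊎ q ≡ t → r ≢ z
      not-z (inj₁ refl) = r≢q
      not-z (inj₂ refl) refl = ¬zt root cr cq
      not-t : q ≡ z ⊎ q ≡ t → r ≢ t
      not-t (inj₁ refl) refl = ¬zt root cq cr
      not-t (inj₂ refl) = r≢q
    Two : Set
    Two = ∃ λ r → ∃ λ s → C r ≡ true × C s ≡ true × c₀ ≢ r × c₀ ≢ s × r ≢ s
    two : ∀ {p q} → p ≡ x ⊎ p ≡ y → q ≡ z ⊎ q ≡ t → c₀ ~ p → c₀ ~ q → Two
    two {p} {q} hp hq cp cq =
      let (r , cr , r∉) = nbr-avoiding c₀ (p ∷ q ∷ []) (s≤s (s≤s z≤n))
          (s , cs , s∉) = nbr-avoiding c₀ (p ∷ q ∷ r ∷ []) ≤-refl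
      in r , s , absorbed hp hq cp cq cr (r∉ ∘ here) (r∉ ∘ there ∘ here)
               , absorbed hp hq cp cq cs (s∉ ∘ here) (s∉ ∘ there ∘ here)
               , ~⇒≢ cr , ~⇒≢ cs , λ e → s∉ (there (there (here (≡-sym e))))
    nbrs-in : c₀ ~ x ⊎ c₀ ~ y → c₀ ~ z ⊎ c₀ ~ t → Two
    nbrs-in (inj₁ a) (inj₁ b) = two (inj₁ refl) (inj₁ refl) a b
    nbrs-in (inj₁ a) (inj₂ b) = two (inj₁ refl) (inj₂ refl) a b
    nbrs-in (inj₂ a) (inj₁ b) = two (inj₂ refl) (inj₁ refl) a b
    nbrs-in (inj₂ a) (inj₂ b) = two (inj₂ refl) (inj₂ refl) a b
    finish : Two → PLinked x y z t
    finish (r , s , cr , cs , n₁ , n₂ , n₃) = pigeon-select rig clique root cr cs n₁ n₂ n₃ (xy root) (xy cr) (xy cs)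

  rigid-linked : ∀ {x y z t v w C} → Rigid x y z t v w C → PLinked x y z t
  rigid-linked {x} {y} {z} {t} {C = C} rig = decide inner?
    where
    open Rigid rig
    open InStuck cfg stk using (induct)
    Inner : Set
    Inner = ∃ λ e → ∃ λ m → ∃ λ e′ → C e ≡ true × C m ≡ true × C e′ ≡ true × e ≢ e′ × ¬ e ~ e′ × m ~ e × m ~ e′
    inner? : Dec Inner
    inner? = any? λ e → any? λ m → any? λ e′ → (C e Boolₚ.≟ true) ×-dec (C m Boolₚ.≟ true) ×-dec (C e′ Boolₚ.≟ true)
      ×-dec ¬? (e ≟F e′) ×-dec ¬? (e ~? e′) ×-dec (m ~? e) ×-dec (m ~? e′)
    decide : Dec Inner → PLinked x y z t
    decide (yes (e , m , e′ , ce , cm , ce′ , e≢ , e≁ , me , me′)) = plinked-via (pair e≢ e≁ me me′)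
      (plinked-sym (InRigid.inner-pair (rigid-flip rig) ce cm ce′ e≢ e≁ me me′)) (InRigid.inner-pair rig ce cm ce′ e≢ e≁ me me′)
    decide (no none) = clique-linked rig clique
      where
      clique : ∀ {s q} → C s ≡ true → C q ≡ true → s ≢ q → s ~ q
      clique {s} {q} cs cq s≢q = near (induct (λ q → q ≡ s ⊎ s ~ q) cs (inj₁ refl) spread cq)
        where
        near : q ≡ s ⊎ s ~ q → s ~ q
        near (inj₁ e) = ⊥-elim (s≢q (≡-sym e))
        near (inj₂ a) = a
        spread : ∀ {p r} → C p ≡ true → C r ≡ true → p ~ r → p ≡ s ⊎ s ~ p → r ≡ s ⊎ s ~ r
        spread cp cr pr (inj₁ refl) = inj₂ pr
        spread {p} {r} cp cr pr (inj₂ sp) with r ≟F s | s ~? r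
        ... | yes e | _ = inj₁ e
        ... | no _ | yes a = inj₂ a
        -- A connected set without an induced path on three vertices is a clique.
        ... | no r≢s | no ¬a = ⊥-elim (none (s , p , r , cs , cp , cr , r≢s ∘ ≡-sym , ¬a , ~-sym sp , pr))

  stuck-linked : ∀ m {x y z t v w C} → Config x y z t v w → Stuck x y z t C → count C < m → PLinked x y z t
  stuck-linked (suc m) {x} {y} {z} {t} {v} {w} {C} cfg stk h =
    go (I₁.reducible?) (I₂.reducible?) (I₃.reducible?) (I₄.reducible?)
    where
    module I₁ = InStuck cfg stk
    module I₂ = InStuck (config-swap cfg) (stuck-swap stk)
    module I₃ = InStuck (config-flip cfg) (stuck-flip stk)
    module I₄ = InStuck (config-swap (config-flip cfg)) (stuck-swap (stuck-flip stk))
    IH : ∀ {x y z t v w C′} → Config x y z t v w → Stuck x y z t C′ → count C′ < count C → PLinked x y z t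
    IH cfg′ stk′ lt = stuck-linked m cfg′ stk′ (≤-trans lt (s≤s⁻¹ h))
    go : Dec I₁.Reducible → Dec I₂.Reducible → Dec I₃.Reducible → Dec I₄.Reducible → PLinked x y z t
    go (yes r) _ _ _ = I₁.reduce IH r
    go _ (yes r) _ _ = plinked-swap {y} (I₂.reduce IH r)
    go _ _ (yes r) _ = plinked-sym {z} (I₃.reduce IH r)
    go _ _ _ (yes r) = plinked-sym {z} (plinked-swap {t} (I₄.reduce IH r))
    go (no a) (no b) (no c) (no d) = rigid-linked record { cfg = cfg ; stk = stk
      ; xy = irreducible⇒cover cfg stk a b ; zt = irreducible⇒cover (config-flip cfg) (stuck-flip stk) c d }

  config-linked : ∀ {x y z t v w} → Config x y z t v w → PLinked x y z t
  config-linked {x} {y} {z} {t} cfg = go (reaching-or-stuck x y z t)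
    where
    open Config cfg
    go : Reaching x y z t ⊎ (∃ λ C → Stuck x y z t C) → PLinked x y z t
    go (inj₁ R) = reaching⇒plinked P Q x≢z x≢t y≢z y≢t R
    go (inj₂ (C , stk)) = stuck-linked _ cfg stk ≤-refl

-- Pairs sharing a vertex

module Identical {n : ℕ} (G : Graph n) (connected : Connected 4 G) {k : ℕ}
  (reg : ∀ v → count (adj G v) ≡ k) (L : ListAssignment n) (ass : IsKAssignment k L)
  (same : ∀ r t {c} → c ∈ L r → c ∈ L t) where

  open Disjoint G connected reg L ass same

  -- If no pair {a,b} is linked to both {x,y} and {x,z}, then V ∖ {v,x,y,z} is a clique, and
  -- counting the edges at its vertices contradicts k ≥ 4.
  module NoDetour {x y z v : Fin n} (p : Pair x y v) (q : Pair x z v) (yz : y ~ z)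
    (none : ∀ {a b u} → Pair a b u → All (a ≢_) (v ∷ x ∷ y ∷ z ∷ []) → All (b ≢_) (v ∷ x ∷ y ∷ z ∷ []) →
      All (u ≢_) (x ∷ y ∷ z ∷ []) → ⊥) where

    Rest : Fin n → Set
    Rest a = All (a ≢_) (v ∷ x ∷ y ∷ z ∷ [])

    rest : ∀ {a} → a ≢ v → a ∉ x ∷ y ∷ z ∷ [] → Rest a
    rest a≢v a∉ = a≢v ∷ ¬Any⇒All¬ _ a∉

    adjacent : ∀ {a b u} → Rest a → Rest b → u ∉ x ∷ y ∷ z ∷ [] → u ~ a → u ~ b → a ≢ b → a ~ b
    adjacent {a} {b} ra rb u∉ ua ub a≢b = decidable-stable (a ~? b) λ a≁b → none (pair a≢b a≁b ua ub) ra rb (¬Any⇒All¬ _ u∉)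

    v∉ : v ∉ x ∷ y ∷ z ∷ []
    v∉ = ∉-intro (~⇒≢ (nbr₁ p) ∷ ~⇒≢ (nbr₂ p) ∷ ~⇒≢ (nbr₂ q) ∷ [])

    hub : ∃ λ m → v ~ m × m ∉ x ∷ y ∷ z ∷ []
    hub = nbr-avoiding v (x ∷ y ∷ z ∷ []) ≤-refl

    m : Fin n
    m = proj₁ hub

    m∉ : m ∉ x ∷ y ∷ z ∷ []
    m∉ = proj₂ (proj₂ hub)

    m-rest : Rest m
    m-rest = rest (~⇒≢ (proj₁ (proj₂ hub)) ∘ ≡-sym) m∉

    Near : Fin n → Set
    Near a = a ≡ v ⊎ a ≡ m ⊎ m ~ a

    all-near : ∀ {a} → Rest a → a ≡ m ⊎ m ~ a
    all-near {a} (a≢v ∷ a≢) = strip (along (walk-avoiding (x ∷ y ∷ z ∷ []) ≤-refl m∉ (∉-intro a≢)) (inj₂ (inj₁ refl)))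
      where
      strip : Near a → a ≡ m ⊎ m ~ a
      strip (inj₁ e) = ⊥-elim (a≢v e)
      strip (inj₂ h) = h
      spread : ∀ {s t} → s ∉ x ∷ y ∷ z ∷ [] → t ∉ x ∷ y ∷ z ∷ [] → s ~ t → Near s → Near t
      spread {s} {t} s∉ t∉ st h with t ≟F v | t ≟F m
      ... | yes e | _ = inj₁ e
      ... | no _ | yes e = inj₂ (inj₁ e)
      spread s∉ t∉ st (inj₁ refl) | no t≢v | no t≢m =
        inj₂ (inj₂ (adjacent m-rest (rest t≢v t∉) s∉ (proj₁ (proj₂ hub)) st (t≢m ∘ ≡-sym)))
      spread s∉ t∉ st (inj₂ (inj₁ refl)) | no t≢v | no t≢m = inj₂ (inj₂ st)
      spread s∉ t∉ st (inj₂ (inj₂ ms)) | no t≢v | no t≢m =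
        inj₂ (inj₂ (adjacent m-rest (rest t≢v t∉) s∉ (~-sym ms) st (t≢m ∘ ≡-sym)))
      along : ∀ {s t} → Walk G (_∉ x ∷ y ∷ z ∷ []) s t → Near s → Near t
      along (stop _) h = h
      along (move s∉ st W) h = along W (spread s∉ (walk-start G W) st h)

    clique : ∀ {a b} → Rest a → Rest b → a ≢ b → a ~ b
    clique {a} {b} ra rb a≢b = go (all-near ra) (all-near rb)
      where
      go : a ≡ m ⊎ m ~ a → b ≡ m ⊎ m ~ b → a ~ b
      go (inj₁ refl) (inj₁ refl) = ⊥-elim (a≢b refl)
      go (inj₁ refl) (inj₂ mb) = mb
      go (inj₂ ma) (inj₁ refl) = ~-sym ma
      go (inj₂ ma) (inj₂ mb) = adjacent ra rb m∉ ma mb a≢b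

    nbr-x⇒rest : ∀ {a} → x ~ a → a ≢ v → Rest a
    nbr-x⇒rest xa a≢v = a≢v ∷ ~⇒≢ (~-sym xa) ∷ (λ { refl → nonadj p xa }) ∷ (λ { refl → nonadj q xa }) ∷ []

    -- Vertex `a` sees all of `f` except `ys`, and the longer list `xs` besides, so its degree
    -- exceeds the size of `f`.
    overfull : ∀ {a j} (f : Fin n → Bool) xs ys → Unique xs → All (λ s → adj G a s ≡ true) xs → length ys < length xs →
      (∀ s → (f ∖∖ ys) s ≡ true → a ~ s × s ∉ xs) → count f ≡ j → count (adj G a) ≡ j → ⊥
    overfull {a} f xs ys u h lt sub e e′ = <⇒≱
      (≤-trans (ℕₚ.+-monoˡ-< (count (f ∖∖ ys)) lt)
        (≤-trans (≤-reflexive (+-comm (length xs) _)) (count+length≤count (f ∖∖ ys) (adj G a) xs u h sub)))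
      (≤-trans (≤-reflexive (trans e′ (≡-sym e))) (count≤length+removed f ys))

    -- By the clique property `a` sees every neighbour of `x` except `v` and possibly itself. Adding
    -- `y`, `e` and, if adjacent, `x` makes its degree exceed that of `x`.
    crowded : ∀ {a e} → Rest a → a ~ y → a ~ e → ¬ x ~ e → e ≢ y → e ≢ x → ⊥
    crowded {a} {e} ra ay ae x≁e e≢y e≢x with x ~? a
    ... | yes xa = overfull (adj G x) (x ∷ y ∷ e ∷ []) (v ∷ a ∷ [])
          ((apart p ∷ (e≢x ∘ ≡-sym) ∷ []) ∷ ((e≢y ∘ ≡-sym) ∷ []) ∷ [] ∷ []) (~-sym xa ∷ ay ∷ ae ∷ []) ≤-refl sub (reg x) (reg a)
      where
      sub : ∀ s → (adj G x ∖∖ (v ∷ a ∷ [])) s ≡ true → a ~ s × s ∉ x ∷ y ∷ e ∷ []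
      sub s h = let (xs , s∉) = ∖∖-elim (adj G x) (v ∷ a ∷ []) h in
        clique ra (nbr-x⇒rest xs (s∉ ∘ here)) (λ e → s∉ (there (here (≡-sym e)))) ,
        ∉-intro (~⇒≢ (~-sym xs) ∷ (λ { refl → nonadj p xs }) ∷ (λ { refl → x≁e xs }) ∷ [])
    ... | no x≁a = overfull (adj G x) (y ∷ e ∷ []) (v ∷ []) (((e≢y ∘ ≡-sym) ∷ []) ∷ [] ∷ []) (ay ∷ ae ∷ []) ≤-refl sub (reg x) (reg a)
      where
      sub : ∀ s → (adj G x ∖∖ (v ∷ [])) s ≡ true → a ~ s × s ∉ y ∷ e ∷ []
      sub s h = let (xs , s∉) = ∖∖-elim (adj G x) (v ∷ []) h in
        clique ra (nbr-x⇒rest xs (s∉ ∘ here)) (λ { refl → x≁a xs }) ,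
        ∉-intro ((λ { refl → nonadj p xs }) ∷ (λ { refl → x≁e xs }) ∷ [])

    impossible : ⊥
    impossible =
      let (a₁ , ya₁ , a₁∉) = nbr-avoiding y (v ∷ z ∷ []) (s≤s (s≤s z≤n))
          (a₂ , ya₂ , a₂∉) = nbr-avoiding y (v ∷ z ∷ a₁ ∷ []) ≤-refl
          (b₁ , zb₁ , b₁∉) = nbr-avoiding z (v ∷ y ∷ []) (s≤s (s≤s z≤n))
          (b₂ , zb₂ , b₂∉) = nbr-avoiding z (v ∷ y ∷ b₁ ∷ []) ≤-refl
          seen = all-seen ya₁ ya₂ (y-rest ya₁ (a₁∉ ∘ here) (a₁∉ ∘ there ∘ here)) (y-rest ya₂ (a₂∉ ∘ here) (a₂∉ ∘ there ∘ here))
                   (λ e → a₂∉ (there (there (here (≡-sym e)))))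
          r₁ = z-rest zb₁ (b₁∉ ∘ here) (b₁∉ ∘ there ∘ here)
          r₂ = z-rest zb₂ (b₂∉ ∘ here) (b₂∉ ∘ there ∘ here)
      -- By now `x` sees `v` and all the rest, including `b₁` and `b₂`, which `y` does not see. Of
      -- the neighbours of `y`, only `v` and `z` lie outside the rest.
      in overfull (adj G y) (v ∷ b₁ ∷ b₂ ∷ []) (v ∷ z ∷ [])
        (((λ e → b₁∉ (here (≡-sym e))) ∷ (λ e → b₂∉ (here (≡-sym e))) ∷ []) ∷ ((λ e → b₂∉ (there (there (here (≡-sym e))))) ∷ []) ∷ [] ∷ [])
        (~-sym (nbr₁ p) ∷ seen r₁ ∷ seen r₂ ∷ []) ≤-refl
        (λ s h → let (ys , s∉) = ∖∖-elim (adj G y) (v ∷ z ∷ []) h in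
          seen (y-rest ys (s∉ ∘ here) (s∉ ∘ there ∘ here)) ,
          ∉-intro ((s∉ ∘ here) ∷ (λ { refl → apart-yz r₁ ys zb₁ }) ∷ (λ { refl → apart-yz r₂ ys zb₂ }) ∷ []))
        (reg y) (reg x)
      where
      y-rest : ∀ {a} → y ~ a → a ≢ v → a ≢ z → Rest a
      y-rest ya a≢v a≢z = a≢v ∷ (λ { refl → nonadj p (~-sym ya) }) ∷ ~⇒≢ (~-sym ya) ∷ a≢z ∷ []
      z-rest : ∀ {a} → z ~ a → a ≢ v → a ≢ y → Rest a
      z-rest za a≢v a≢y = a≢v ∷ (λ { refl → nonadj q (~-sym za) }) ∷ a≢y ∷ ~⇒≢ (~-sym za) ∷ []
      apart-yz : ∀ {a} → Rest a → y ~ a → z ~ a → ⊥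
      apart-yz ra ya za = crowded ra (~-sym ya) (~-sym za) (nonadj q) (~⇒≢ (~-sym yz)) (apart q ∘ ≡-sym)
      all-seen : ∀ {a₁ a₂} → y ~ a₁ → y ~ a₂ → Rest a₁ → Rest a₂ → a₁ ≢ a₂ → ∀ {b} → Rest b → x ~ b
      all-seen {a₁} {a₂} ya₁ ya₂ r₁ r₂ a₁≢a₂ {b} rb@(_ ∷ b≢x ∷ b≢y ∷ _) = decidable-stable (x ~? b) missed
        where
        missed : ¬ ¬ x ~ b
        missed x≁b with b ≟F a₁
        ... | yes refl = crowded r₂ (~-sym ya₂) (clique r₂ rb (a₁≢a₂ ∘ ≡-sym)) x≁b b≢y b≢x
        ... | no b≢a₁  = crowded r₁ (~-sym ya₁) (clique r₁ rb (b≢a₁ ∘ ≡-sym)) x≁b b≢y b≢x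

  share-adjacent : ∀ {x y z v} → Pair x y v → Pair x z v → y ~ z → PLinked x y x z
  share-adjacent {x} {y} {z} {v} p q yz = decide detour?
    where
    distinct? : ∀ a xs → Dec (All (a ≢_) xs)
    distinct? a = All.all? (λ b → ¬? (a ≟F b))
    pair? : ∀ a b u → Dec (Pair a b u)
    pair? a b u = map′ (λ (e , f , g , h) → pair e f g h) (λ r → apart r , nonadj r , nbr₁ r , nbr₂ r)
      (¬? (a ≟F b) ×-dec ¬? (a ~? b) ×-dec (u ~? a) ×-dec (u ~? b))
    Detour : Set
    Detour = ∃ λ a → ∃ λ b → ∃ λ u → Pair a b u × All (a ≢_) (v ∷ x ∷ y ∷ z ∷ []) × All (b ≢_) (v ∷ x ∷ y ∷ z ∷ []) ×
      All (u ≢_) (x ∷ y ∷ z ∷ [])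
    detour? : Dec Detour
    detour? = any? λ a → any? λ b → any? λ u → pair? a b u ×-dec distinct? a _ ×-dec distinct? b _ ×-dec distinct? u _
    decide : Dec Detour → PLinked x y x z
    decide (yes (a , b , u , r , a≢v ∷ a≢x ∷ a≢y ∷ a≢z ∷ [] , b≢v ∷ b≢x ∷ b≢y ∷ b≢z ∷ [] , u≢x ∷ u≢y ∷ u≢z ∷ [])) =
      plinked-via r (config-linked (config p a≢x a≢y b≢x b≢y u≢x u≢y))
        (plinked-sym {x} (config-linked (config q a≢x a≢z b≢x b≢z u≢x u≢z)))
      where
      config : ∀ {s} → Pair x s v → a ≢ x → a ≢ s → b ≢ x → b ≢ s → u ≢ x → u ≢ s → Config x s a b v u
      config p′ ax as bx bs ux us = record { P = p′ ; Q = r ; x≢z = ax ∘ ≡-sym ; x≢t = bx ∘ ≡-sym ; y≢z = as ∘ ≡-sym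
        ; y≢t = bs ∘ ≡-sym ; v≢z = a≢v ∘ ≡-sym ; v≢t = b≢v ∘ ≡-sym ; w≢x = ux ; w≢y = us }
    decide (no none) = ⊥-elim (NoDetour.impossible p q yz λ {a} {b} {u} r ra rb ru → none (a , b , u , r , ra , rb , ru))

  share : ∀ {x y z v} → Pair x y v → Pair x z v → PLinked x y x z
  share {x} {y} {z} p q with y ≟F z | y ~? z
  ... | yes refl | _ = pair-self p
  ... | no _ | yes yz = share-adjacent p q yz
  ... | no y≢z | no y≁z = triple p q y≢z y≁z

  pairs-linked : ∀ {x y z t v} → Pair x y v → Pair z t v → PLinked x y z t
  pairs-linked {x} {y} {z} {t} p q with x ≟F z | x ≟F t | y ≟F z | y ≟F t
  ... | yes refl | _ | _ | _ = share p q
  ... | _ | yes refl | _ | _ = plinked-swapʳ {x} {y} (share p (pair-swap q))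
  ... | _ | _ | yes refl | _ = plinked-swap {y} (share (pair-swap p) q)
  ... | _ | _ | _ | yes refl = plinked-swap {y} (plinked-swapʳ {y} {x} (share (pair-swap p) (pair-swap q)))
  ... | no x≢z | no x≢t | no y≢z | no y≢t = config-linked record { P = p ; Q = q ; x≢z = x≢z ; x≢t = x≢t ; y≢z = y≢z ; y≢t = y≢t
    ; v≢z = ~⇒≢ (nbr₁ q) ; v≢t = ~⇒≢ (nbr₂ q) ; w≢x = ~⇒≢ (nbr₁ p) ; w≢y = ~⇒≢ (nbr₂ p) }

  pair-at : ∀ {φ} → LCol φ → ∀ v → ∃ λ x → ∃ λ y → Pair x y v × φ x ≡ φ y
  pair-at {φ} cφ v with waste-at cφ v
  ... | inj₁ (t , _ , t∉) = ⊥-elim (t∉ (same t v (proj₂ cφ t)))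
  ... | inj₂ (x , y , x≢y , vx , vy , e , _) = x , y , pair x≢y (λ a → proj₁ cφ x y a e) vx vy , e

  swappable : ∀ {x y v} → x ≢ y → ¬ x ~ y → v ~ x → v ~ y → LSwappable G L
  swappable x≢y x≁y vx vy = (let (φ , cφ , _) = inhabited (pair-class (pair x≢y x≁y vx vy)) in φ , cφ) , λ φ ψ cφ cψ →
    -- Both pairs are taken at the same vertex, so only pairs with a common neighbour need linking.
    let (x , y , q , e) = pair-at cφ x₀
        (z , t , r , e′) = pair-at cψ x₀
    in pairs-linked q r cφ cψ e e′

n≤1+degree : ∀ {n} (G : Graph n) v → (∀ t → v ≢ t → Adj G v t) → n ≤ suc (count (adj G v))
n≤1+degree {n} G v all = ≤-trans (≤-reflexive (≡-sym (count-all n))) (≤-trans (count≤1+remove (λ _ → true) v)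
  (s≤s (count-mono {p = (λ _ → true) ∖ v} {q = adj G v} λ t e → all t (proj₂ (∖-elim (λ _ → true) e) ∘ ≡-sym))))

1+degree≤n : ∀ {n} (G : Graph n) v → suc (count (adj G v)) ≤ n
1+degree≤n {n} G v = ≤-trans (≤-reflexive (+-comm 1 _)) (≤-trans
  (count+length≤count (adj G v) (λ _ → true) (v ∷ []) ([] ∷ []) (refl ∷ []) λ t a → refl , λ { (here e) → adj⇒≢ G a (≡-sym e) })
  (≤-reflexive (count-all n)))

Cherry : ∀ {n} → Graph n → Set
Cherry G = ∃ λ x → ∃ λ v → ∃ λ y → x ≢ y × ¬ Adj G x y × Adj G v x × Adj G v y

cherry? : ∀ {n} (G : Graph n) → Dec (Cherry G)
cherry? G = any? λ x → any? λ v → any? λ y → ¬? (x ≟F y) ×-dec ¬? (adj G x y Boolₚ.≟ true) ×-dec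
  (adj G v x Boolₚ.≟ true) ×-dec (adj G v y Boolₚ.≟ true)

no-cherry⇒adjacent : ∀ {n} (G : Graph n) → ¬ Cherry G → ∀ {P u v} → Walk G P u v → u ≢ v → Adj G u v
no-cherry⇒adjacent {n} G none {P} {u} {v} W u≢v = go W (inj₁ refl)
  where
  go : ∀ {s} → Walk G P s v → s ≡ u ⊎ Adj G u s → Adj G u v
  go (stop _) (inj₁ e) = ⊥-elim (u≢v (≡-sym e))
  go (stop _) (inj₂ a) = a
  go (move _ a W) (inj₁ refl) = go W (inj₂ a)
  go (move {u = s} {w = t} _ b W) (inj₂ a) with t ≟F u | adj G u t Boolₚ.≟ true
  ... | yes e | _ = go W (inj₁ e)
  ... | no _ | yes c = go W (inj₂ c)
  ... | no t≢u | no ¬c = ⊥-elim (none (u , s , t , t≢u ∘ ≡-sym , ¬c , adj-sym G a , b))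

theorem4 : ∀ {n} (G : Graph n) → Connected 4 G →
    (∀ (k : ℕ) → Regular G k → ¬ IsComplete G (suc k) → Swappable G k) ×
    (∀ (k : ℕ) → IsComplete G (suc k) → (L : ListAssignment n) → IsKAssignment k L →
    (∃ λ u → ∃ λ w → ¬ SameList (L u) (L w)) → LSwappable G L)
theorem4 {n} G connected = regular , complete
  where
  regular : ∀ k → Regular G k → ¬ IsComplete G (suc k) → Swappable G k
  regular k R ¬K L ass = decide (any? λ r → any? λ t → differ? r t)
    where
    reg : ∀ v → count (adj G v) ≡ k
    reg v = trans (≡-sym (degree≡count G v)) (R v)
    open Arcs G connected reg L ass
    open Colourings G connected reg L ass using (x₀; walk-avoiding)
    -- Without an induced path on three vertices the connected graph would be complete, and its
    -- degree `k` would make it the excluded one.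
    cherry : Cherry G
    cherry = decidable-stable (cherry? G) λ none →
      let full = λ u v → no-cherry⇒adjacent G none (walk-avoiding [] z≤n {u} {v} (λ ()) (λ ())) in
      ¬K (ℕₚ.≤-antisym (subst (λ d → n ≤ suc d) (reg x₀) (n≤1+degree G x₀ (full x₀)))
                       (subst (λ d → suc d ≤ n) (reg x₀) (1+degree≤n G x₀)) , full)
    decide : Dec (∃ λ r → ∃ λ t → Differ r t) → LSwappable G L
    decide (yes (_ , _ , D)) = lists-differ⇒swappable D
    decide (no none) = let (_ , _ , _ , x≢y , x≁y , vx , vy) = cherry in I.swappable x≢y x≁y vx vy
      where
      same : ∀ r t {c} → c ∈ L r → c ∈ L t
      same r t = ¬differ⇒⊆ λ D → none (r , t , D)
      module I = Identical G connected reg L ass same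

  complete : ∀ k → IsComplete G (suc k) → (L : ListAssignment n) → IsKAssignment k L →
    (∃ λ u → ∃ λ w → ¬ SameList (L u) (L w)) → LSwappable G L
  complete k (n≡ , full) L ass (u , w , ¬same) = lists-differ⇒swappable (decidable-stable (differ? u w) λ ¬D →
      ¬same λ c → ¬differ⇒⊆ ¬D , ¬differ⇒⊆ (¬D ∘ differ-sym))
    where
    reg : ∀ v → count (adj G v) ≡ k
    reg v = ℕₚ.≤-antisym (s≤s⁻¹ (subst (suc (count (adj G v)) ≤_) n≡ (1+degree≤n G v)))
                         (s≤s⁻¹ (subst (_≤ suc (count (adj G v))) n≡ (n≤1+degree G v (full v))))
    open Arcs G connected reg L ass
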